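{- For each $r$-tuple $\mathfrak{s}=(s_1,\ldots,s_r)\in\mathbb{N}^r$, with $(E',\rho)$ and $\mathbf{v}_{\mathfrak{s}}\in E'(\overline{k})$ the $t$-module and point attached to $\mathfrak{s}$ (defined in the context): (a) the $t$-module $E'$ is defined over $A$, i.e. $\rho_t\in\mathrm{Mat}_d(A[\tau])$; (b) the point $\mathbf{v}_{\mathfrak{s}}$ is an integral point in $E'(A)=\mathrm{Mat}_{d\times1}(A)$.
   Context: Notation. $\mathbb{N}$ is the set of positive integers; $q$ is a power of a prime $p$; $\theta,t$ are independent variables; $A=\mathbb{F}_q[\theta]$, $k=\mathbb{F}_q(\theta)$, $\overline{k}$ an algebraic closure of $k$. Anderson–Thakur polynomials. Let $D_0=1$, $D_i=\prod_{j=0}^{i-1}(\theta^{q^i}-\theta^{q^j})$. For $n=\sum_i n_iq^i\geq 0$ with $0\le n_i\le q-1$, $\Gamma_{n+1}=\prod_iD_i^{n_i}\in A$. $G_0(y)=1$, $G_n(y)=\prod_{i=1}^n(t^{q^n}-y^{q^i})$; $H_n\in A[t]$ ($n\geq 0$) is defined by $\big(1-\sum_{i\ge0}\frac{G_i(\theta)}{D_i|_{\theta=t}}x^{q^i}\big)^{ -1}=\sum_{n\ge0}\frac{H_n}{\Gamma_{n+1}|_{\theta=t}}x^n$. Frobenius module $M'$. For $f=\sum a_it^i$ put $f^{(-1)}=\sum a_i^{1/q}t^i$. $\overline{k}[t,\sigma]$ is the noncommutative $\overline{k}[t]$-algebra generated by $\sigma$ with $\sigma f=f^{(-1)}\sigma$.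 Let $M'$ be the left $\overline{k}[t,\sigma]$-module, free over $\overline{k}[t]$ with basis $m_1,\ldots,m_r$, with $\sigma m_1=(t-\theta)^{s_1+\cdots+s_r}m_1$ and $\sigma m_\ell=H_{s_{\ell-1}-1}^{(-1)}(t-\theta)^{s_{\ell-1}+\cdots+s_r}m_{\ell-1}+(t-\theta)^{s_\ell+\cdots+s_r}m_\ell$ for $2\le\ell\le r$. The $t$-module $(E',\rho)$. Put $d=(s_1+\cdots+s_r)+(s_2+\cdots+s_r)+\cdots+s_r$. $M'$ is a free left $\overline{k}[\sigma]$-module with basis $\nu_1,\ldots,\nu_d$ given, in order, by $(t-\theta)^{s_1+\cdots+s_r-1}m_1,\ldots,(t-\theta)m_1,m_1,\ldots,(t-\theta)^{s_r-1}m_r,\ldots,(t-\theta)m_r,m_r$. Define $\delta:\overline{k}[\sigma]\to\overline{k}$ by $\delta(\sum_ic_i\sigma^i)=\sum_ic_i^{q^i}$ and $\Delta:M'\to\mathrm{Mat}_{d\times1}(\overline{k})$ by $\Delta(\sum u_i\nu_i)=(\delta(u_1),\ldots,\delta(u_d))^{\mathrm{tr}}$. $\Delta$ is surjective, $\mathbb{F}_q$-linear, with kernel $(\sigma-1)M'$, which is stable under $\mathbb{F}_q[t]$; so $\mathrm{Mat}_{d\times1}(\overline{k})$ inherits an $\mathbb{F}_q[t]$-module structure, given by an $\mathbb{F}_q$-linear ring homomorphism $\rho:\mathbb{F}_q[t]\to\mathrm{Mat}_d(\overline{k}[\tau])$, $\tau$ the $q$-power Frobenius, with $\rho_a(\Delta(m))=\Delta(am)$.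 $(E',\rho)$ is this $t$-module, with $E'(\overline{k})=\mathrm{Mat}_{d\times1}(\overline{k})$. The special point is $\mathbf{v}_{\mathfrak{s}}=\Delta\big(H_{s_r-1}^{(-1)}(t-\theta)^{s_r}m_r\big)$. -}

module Defs where

open import Algebra.Apartness.Bundles using (HeytingField; HeytingCommutativeRing)
open import Algebra.Bundles using (CommutativeRing)
open import Algebra.Bundles.Raw using (RawRing)
import Algebra.Apartness.Properties.HeytingCommutativeRing as HeytingProperties
import Algebra.Definitions.RawMonoid as RawMonoidDefs
import Algebra.Definitions.RawSemiring as RawSemiringDefs
open import Algebra.Morphism.Structures using (IsRingHomomorphism; IsRingMonomorphism)
open import Data.Fin.Base using (Fin; zero; suc; toℕ; inject₁; fromℕ; splitAt)
import Data.Fin.Properties as Fin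
open import Data.List.Base as List using (List; []; _∷_; _++_; [_]; replicate; lookup)
open import Data.Nat.Base as ℕ using (ℕ; zero; suc; pred; _∸_; NonZero)
open import Data.Nat.DivMod using (_/_; _%_)
import Data.Nat.Properties as ℕ
open import Data.Nat.Primality using (Prime; prime⇒nonZero)
open import Data.Product.Base as Product using (Σ; ∃-syntax; _×_; _,_; proj₁; proj₂)
open import Data.Sum.Base using ([_,_]′)
open import Data.Vec.Functional using (Vector; tail)
open import Function.Base using (_∘_; id)
open import Function.Bundles using (Inverse)
open import Level using (Level; _⊔_) renaming (suc to lsuc)
open import Relation.Binary.Definitions using (Decidable)
open import Relation.Binary.PropositionalEquality as ≡ using (_≡_)
open import Relation.Nullary.Decidable using (yes; no)
open import Relation.Nullary.Negation using (¬_)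

module Ops {c ℓ : Level} (R : RawRing c ℓ) where
  open RawRing R public
  open RawSemiringDefs rawSemiring public using (_^_; sum; product)

  infixl 6 _-_
  _-_ : Carrier → Carrier → Carrier
  x - y = x + (- y)

-- A polynomial is the list of its coefficients, constant term first.
-- Trailing zeros are allowed; _≈_ compares coefficients.

module Polynomials {c ℓ : Level} (R : RawRing c ℓ) where
  open RawRing R

  coeff : List Carrier → ℕ → Carrier
  coeff []      n       = 0#
  coeff (a ∷ f) zero    = a
  coeff (a ∷ f) (suc n) = coeff f n

  infix  4 _≈ᴾ_
  infixl 6 _+ᴾ_
  infixl 7 _*ᴾ_ _·ᴾ_

  _≈ᴾ_ : List Carrier → List Carrier → Set ℓ
  f ≈ᴾ g = ∀ n → coeff f n ≈ coeff g n

  _+ᴾ_ : List Carrier → List Carrier → List Carrier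
  []      +ᴾ g       = g
  (a ∷ f) +ᴾ []      = a ∷ f
  (a ∷ f) +ᴾ (b ∷ g) = (a + b) ∷ (f +ᴾ g)

  _·ᴾ_ : Carrier → List Carrier → List Carrier
  a ·ᴾ f = List.map (a *_) f

  _*ᴾ_ : List Carrier → List Carrier → List Carrier
  []      *ᴾ g = []
  (a ∷ f) *ᴾ g = a ·ᴾ g +ᴾ (0# ∷ f *ᴾ g)

  const : Carrier → List Carrier
  const a = [ a ]

  X : List Carrier
  X = 0# ∷ 1# ∷ []

  eval : List Carrier → Carrier → Carrier
  eval []      x = 0#
  eval (a ∷ f) x = a + x * eval f x

Poly : ∀ {c ℓ} → RawRing c ℓ → RawRing c ℓ
Poly R = record
  { Carrier = List Carrier
  ; _≈_     = _≈ᴾ_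
  ; _+_     = _+ᴾ_
  ; _*_     = _*ᴾ_
  ; -_      = List.map (-_)
  ; 0#      = []
  ; 1#      = const 1#
  }
  where
  open RawRing R
  open Polynomials R

-- With decidable apartness, x # y is the same as ¬ (x ≈ y), so this is
-- the constructive rendering of the classical notion of a field.

record DiscreteField c ℓ₁ ℓ₂ : Set (lsuc (c ⊔ ℓ₁ ⊔ ℓ₂)) where
  field
    heytingField : HeytingField c ℓ₁ ℓ₂

  open HeytingField heytingField public
  open HeytingCommutativeRing heytingCommutativeRing public using (commutativeRing)

  field
    _#?_ : Decidable _#_

  rawRing : RawRing c ℓ₁
  rawRing = CommutativeRing.rawRing commutativeRing

  1≉0 : ¬ (1# ≈ 0#)
  1≉0 1≈0 = proj₂ (tight 1# 0#) 1≈0 (HeytingProperties.1#0 heytingCommutativeRing)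

  -- Total division; only values at y # 0# are meaningful.  The inverse
  -- supplied by #⇒invertible is literally that of y - 0#.
  infixl 7 _÷_
  _÷_ : Carrier → Carrier → Carrier
  x ÷ y with y #? 0#
  ... | yes y#0 = x * proj₁ (#⇒invertible y#0)
  ... | no  _   = 0#

record IsFractionField {c ℓ c′ ℓ₁ ℓ₂} (R : RawRing c ℓ) (Q : DiscreteField c′ ℓ₁ ℓ₂)
         (j : RawRing.Carrier R → DiscreteField.Carrier Q) : Set (c ⊔ ℓ ⊔ c′ ⊔ ℓ₁) where
  private
    module R = RawRing R
    module Q = DiscreteField Q
  field
    isRingMonomorphism : IsRingMonomorphism R Q.rawRing j
    fraction           : ∀ x → ∃[ a ] ∃[ b ] (¬ (b R.≈ R.0#)) × (x Q.* j b Q.≈ j a)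

record IsAlgebraicClosure {c ℓ₁ ℓ₂ c′ ℓ₁′ ℓ₂′}
         (k : DiscreteField c ℓ₁ ℓ₂) (K : DiscreteField c′ ℓ₁′ ℓ₂′)
         (ι : DiscreteField.Carrier k → DiscreteField.Carrier K)
         : Set (c ⊔ ℓ₁ ⊔ c′ ⊔ ℓ₁′) where
  private
    module k    = DiscreteField k
    module K    = DiscreteField K
    module k[X] = Polynomials k.rawRing
    module K[X] = Polynomials K.rawRing
  field
    isRingMonomorphism  : IsRingMonomorphism k.rawRing K.rawRing ι
    algebraic           : ∀ x → ∃[ f ] (¬ (f k[X].≈ᴾ [])) × (K[X].eval (List.map ι f) x K.≈ K.0#)
    algebraicallyClosed : ∀ f → (∃[ n ] ¬ (K[X].coeff f (suc n) K.≈ K.0#)) →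
                          ∃[ x ] K[X].eval f x K.≈ K.0#

-- 𝔽 = 𝔽_q, A = 𝔽_q[θ], k = 𝔽_q(θ), K an algebraic closure of k, kt = k(t);
-- each field is any model of its characterisation.

record BaseData c ℓ₁ ℓ₂ : Set (lsuc (c ⊔ ℓ₁ ⊔ ℓ₂)) where
  field
    p e     : ℕ
    p-prime : Prime p
    e-pos   : 1 ℕ.≤ e

  q : ℕ
  q = p ℕ.^ e

  field
    𝔽       : DiscreteField c ℓ₁ ℓ₂
    𝔽-card  : Inverse (CommutativeRing.setoid (DiscreteField.commutativeRing 𝔽)) (≡.setoid (Fin q))

  A : RawRing c ℓ₁
  A = Poly (DiscreteField.rawRing 𝔽)

  A[t] : RawRing c ℓ₁
  A[t] = Poly A

  field
    k      : DiscreteField c ℓ₁ ℓ₂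
    A→k    : RawRing.Carrier A → DiscreteField.Carrier k
    k-frac : IsFractionField A k A→k

    K     : DiscreteField c ℓ₁ ℓ₂
    k→K   : DiscreteField.Carrier k → DiscreteField.Carrier K
    K-alg : IsAlgebraicClosure k K k→K

    kt      : DiscreteField c ℓ₁ ℓ₂
    A[t]→kt : RawRing.Carrier A[t] → DiscreteField.Carrier kt
    kt-frac : IsFractionField A[t] kt A[t]→kt

  instance
    q≢0 : NonZero q
    q≢0 = ℕ.m^n≢0 p e ⦃ prime⇒nonZero p-prime ⦄

-- D, Γ and G as functions of the variables substituted into them: for an
-- element x of a ring, D x i is D_i with θ replaced by x, and so on.

module Carlitz {c ℓ : Level} (q : ℕ) ⦃ _ : NonZero q ⦄ (R : RawRing c ℓ) where
  open Ops R

  D : Carrier → ℕ → Carrier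
  D x i = product {i} λ j → x ^ (q ℕ.^ i) - x ^ (q ℕ.^ toℕ j)

  digit : ℕ → ℕ → ℕ
  digit n i = (n / q ℕ.^ i) % q
    where instance _ = ℕ.m^n≢0 q i

  -- Γ₊₁ x n is Γ_{n+1}; the digits of n of index greater than n vanish.
  Γ₊₁ : Carrier → ℕ → Carrier
  Γ₊₁ x n = product {suc n} λ i → D x (toℕ i) ^ digit n (toℕ i)

  G : (t y : Carrier) → ℕ → Carrier
  G t y n = product {n} λ i → t ^ (q ℕ.^ n) - y ^ (q ℕ.^ suc (toℕ i))

module AndersonThakur {c ℓ₁ ℓ₂ : Level} (B : BaseData c ℓ₁ ℓ₂) where
  open BaseData B
  private
    module A    = RawRing A
    module A[t] = RawRing A[t]
    module L    = DiscreteField kt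
    module LO   = Ops L.rawRing
  open Carlitz q A[t]

  θ t : A[t].Carrier
  θ = Polynomials.const A (Polynomials.X (DiscreteField.rawRing 𝔽))
  t = Polynomials.X A

  -- Formal power series in x over k(t), as coefficient sequences.
  Series : Set c
  Series = ℕ → L.Carrier

  1ˢ : Series
  1ˢ zero    = L.1#
  1ˢ (suc _) = L.0#

  _-ˢ_ _*ˢ_ : Series → Series → Series
  (f -ˢ g) n = f n LO.- g n
  (f *ˢ g) n = LO.sum {suc n} λ i → f (toℕ i) L.* g (n ∸ toℕ i)

  -- Σᵢ (G_i(θ) / D_i|θ=t) x^(qⁱ); qⁱ = n forces i ≤ n.
  kernel : Series
  kernel n = LO.sum {suc n} λ i → term (toℕ i)
    where
    term : ℕ → L.Carrier
    term i with q ℕ.^ i ℕ.≟ n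
    ... | yes _ = A[t]→kt (G t θ i) L.÷ A[t]→kt (D t i)
    ... | no  _ = L.0#

  -- (1 - Σᵢ …)⁻¹ = Σₙ (Hₙ / Γ_{n+1}|θ=t) xⁿ, inverse in the ring of power series.
  IsAndersonThakur : (ℕ → A[t].Carrier) → Set ℓ₁
  IsAndersonThakur H =
    ∀ n → ((1ˢ -ˢ kernel) *ˢ (λ m → A[t]→kt (H m) L.÷ A[t]→kt (Γ₊₁ t m))) n L.≈ 1ˢ n

module Scalars {c ℓ₁ ℓ₂ : Level} (B : BaseData c ℓ₁ ℓ₂) where
  open BaseData B

  K-raw K[t] 𝔽[t] : RawRing c ℓ₁
  K-raw = DiscreteField.rawRing K
  K[t]  = Poly K-raw
  𝔽[t]  = Poly (DiscreteField.rawRing 𝔽)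

  module A = RawRing A
  module K = Ops K-raw
  module K[t] = Ops K[t]
  module 𝔽[t] = RawRing 𝔽[t]
  module A[t] = RawRing A[t]
  module K-poly = Polynomials K-raw
  open K-poly using (coeff; _≈ᴾ_; _+ᴾ_; _·ᴾ_; const)

  ιA : A.Carrier → K.Carrier
  ιA = k→K ∘ A→k

  ι𝔽 : DiscreteField.Carrier 𝔽 → K.Carrier
  ι𝔽 = ιA ∘ Polynomials.const (DiscreteField.rawRing 𝔽)

  θ : K.Carrier
  θ = ιA (Polynomials.X (DiscreteField.rawRing 𝔽))

  t-θ : K[t].Carrier
  t-θ = K-poly.X K[t].- const θ

  frob : ℕ → K.Carrier → K.Carrier
  frob i a = a K.^ (q ℕ.^ i)

  -- a^(1/q), as a root of X^q - a; unique since K has characteristic p.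
  qth-root : K.Carrier → K.Carrier
  qth-root a = proj₁ (IsAlgebraicClosure.algebraicallyClosed K-alg
                 ((K.- a) ∷ X^ (pred q)) (pred q , non-constant))
    where
    X^ : ℕ → List K.Carrier
    X^ n = replicate n K.0# ++ [ K.1# ]

    leading : ∀ n → coeff (X^ n) n ≡ K.1#
    leading zero    = ≡.refl
    leading (suc n) = leading n

    non-constant : ¬ (coeff (X^ (pred q)) (pred q) K.≈ K.0#)
    non-constant rewrite leading (pred q) = DiscreteField.1≉0 K

  infix 9 _⁽⁻¹⁾
  _⁽⁻¹⁾ : K[t].Carrier → K[t].Carrier
  f ⁽⁻¹⁾ = List.map qth-root f

  -- Elements of K[τ] (and of K[σ] below) are coefficient lists with the
  -- coefficients on the left; τ a = a^q τ.

  infixl 7 _*ᵀ_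
  _*ᵀ_ : List K.Carrier → List K.Carrier → List K.Carrier
  []      *ᵀ g = []
  (a ∷ f) *ᵀ g = a ·ᴾ g +ᴾ (K.0# ∷ f *ᵀ List.map (frob 1) g)

  K[τ] : RawRing c ℓ₁
  K[τ] = record
    { Carrier = List K.Carrier
    ; _≈_     = _≈ᴾ_
    ; _+_     = _+ᴾ_
    ; _*_     = _*ᵀ_
    ; -_      = List.map (K.-_)
    ; 0#      = []
    ; 1#      = const K.1#
    }

  evalᵀ : List K.Carrier → K.Carrier → K.Carrier
  evalᵀ f x = K.sum λ i → lookup f i K.* frob (toℕ i) x

module Matrices {c ℓ : Level} (R : RawRing c ℓ) where
  open Ops R

  Mat : ℕ → RawRing c ℓ
  Mat d = record
    { Carrier = Fin d → Fin d → Carrier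
    ; _≈_     = λ M N → ∀ i j → M i j ≈ N i j
    ; _+_     = λ M N i j → M i j + N i j
    ; _*_     = λ M N i j → sum λ l → M i l * N l j
    ; -_      = λ M i j → - M i j
    ; 0#      = λ _ _ → 0#
    ; 1#      = identity
    }
    where
    identity : Fin d → Fin d → Carrier
    identity i j with i Fin.≟ j
    ... | yes _ = 1#
    ... | no  _ = 0#

sumℕ : ∀ {n} → Vector ℕ n → ℕ
sumℕ = RawMonoidDefs.sum ℕ.+-0-rawMonoid

-- weight 𝔰 ℓ = s_ℓ + ⋯ + s_r
weight : ∀ {r} → Vector ℕ r → Vector ℕ r
weight 𝔰 zero    = sumℕ 𝔰
weight 𝔰 (suc ℓ) = weight (tail 𝔰) ℓ

-- Cut Fin (w₁ + ⋯ + w_r) into consecutive blocks of lengths w₁ , … , w_r.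
block : ∀ {r} (w : Vector ℕ r) → Fin (sumℕ w) → Σ (Fin r) (Fin ∘ w)
block {suc r} w i =
  [ zero ,_ , Product.map suc id ∘ block (tail w) ]′ (splitAt (w zero) i)

-- 𝔰 = (s₁ , … , s_r) with r = suc n; M′ is modelled by coordinates with respect to m.

module Construction {c ℓ₁ ℓ₂ : Level} (B : BaseData c ℓ₁ ℓ₂)
         (H : ℕ → RawRing.Carrier (BaseData.A[t] B))
         {n : ℕ} (𝔰 : Vector ℕ (suc n)) where
  open BaseData B
  open Scalars B public
  open Matrices K[τ] using (Mat)

  w : Vector ℕ (suc n)
  w = weight 𝔰

  d : ℕ
  d = sumℕ w

  M′ : Set c
  M′ = Vector K[t].Carrier (suc n)

  infix  4 _≈ᴹ_
  infixl 6 _+ᴹ_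
  infixr 7 _•_

  _≈ᴹ_ : M′ → M′ → Set ℓ₁
  x ≈ᴹ y = ∀ ℓ → x ℓ K[t].≈ y ℓ

  _+ᴹ_ : M′ → M′ → M′
  (x +ᴹ y) ℓ = x ℓ K[t].+ y ℓ

  _•_ : K[t].Carrier → M′ → M′
  (f • x) ℓ = f K[t].* x ℓ

  sumᴹ : ∀ {l} → Vector M′ l → M′
  sumᴹ xs ℓ = K[t].sum λ i → xs i ℓ

  m : Fin (suc n) → M′
  m i j with i Fin.≟ j
  ... | yes _ = K[t].1#
  ... | no  _ = K[t].0#

  -- H_{s_ℓ - 1}^{(-1)}
  H⁽⁻¹⁾ : Fin (suc n) → K[t].Carrier
  H⁽⁻¹⁾ ℓ = List.map ιA (H (pred (𝔰 ℓ))) ⁽⁻¹⁾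

  σm : Fin (suc n) → M′
  σm zero    = (t-θ K[t].^ w zero) • m zero
  σm (suc ℓ) = (H⁽⁻¹⁾ (inject₁ ℓ) K[t].* t-θ K[t].^ w (inject₁ ℓ)) • m (inject₁ ℓ)
               +ᴹ (t-θ K[t].^ w (suc ℓ)) • m (suc ℓ)

  σ : M′ → M′
  σ x = sumᴹ λ ℓ → x ℓ ⁽⁻¹⁾ • σm ℓ

  σ^ : ℕ → M′ → M′
  σ^ zero    x = x
  σ^ (suc i) x = σ (σ^ i x)

  K[σ] : Set c
  K[σ] = List K.Carrier

  infixr 7 _•σ_
  _•σ_ : K[σ] → M′ → M′
  u •σ x = sumᴹ λ i → K-poly.const (lookup u i) • σ^ (toℕ i) x

  δ : K[σ] → K.Carrier
  δ u = K.sum λ i → frob (toℕ i) (lookup u i)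

  ν : Fin d → M′
  ν i = let (ℓ , j) = block w i in (t-θ K[t].^ (w ℓ ∸ suc (toℕ j))) • m ℓ

  Col : Set c
  Col = Vector K.Carrier d

  _≈ᶜ_ : Col → Col → Set ℓ₁
  v ≈ᶜ v′ = ∀ i → v i K.≈ v′ i

  module Matᵀ = RawRing (Mat d)

  _⟨_⟩ : Matᵀ.Carrier → Col → Col
  (P ⟨ v ⟩) i = K.sum λ j → evalᵀ (P i j) (v j)

  _·ᵀ_ : K.Carrier → Matᵀ.Carrier → Matᵀ.Carrier
  (a ·ᵀ P) i j = a K-poly.·ᴾ P i j

  -- Δ, and ρ : 𝔽_q[t] → Mat_d(K[τ]), are given by the equations that determine
  -- them uniquely: the ν i form a K[σ]-basis of M′, Δ is surjective, and a skew
  -- polynomial is determined by its values on the infinite field K.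
  record TModule : Set (c ⊔ ℓ₁) where
    field
      Δ        : M′ → Col
      Δ-expand : ∀ x (u : Vector K[σ] d) → x ≈ᴹ sumᴹ (λ i → u i •σ ν i) → Δ x ≈ᶜ (δ ∘ u)
      ρ        : 𝔽[t].Carrier → Matᵀ.Carrier
      ρ-homo   : IsRingHomomorphism 𝔽[t] (Mat d) ρ
      ρ-linear : ∀ a f → ρ (Polynomials._·ᴾ_ (DiscreteField.rawRing 𝔽) a f) Matᵀ.≈ (ι𝔽 a ·ᵀ ρ f)
      ρ-Δ      : ∀ f x → (ρ f ⟨ Δ x ⟩) ≈ᶜ Δ (List.map ι𝔽 f • x)

    ρ-t : Matᵀ.Carrier
    ρ-t = ρ (Polynomials.X (DiscreteField.rawRing 𝔽))

    special-point : Col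
    special-point = Δ ((H⁽⁻¹⁾ (fromℕ n) K[t].* t-θ K[t].^ 𝔰 (fromℕ n)) • m (fromℕ n))

  IsOverA : Matᵀ.Carrier → Set (c ⊔ ℓ₁)
  IsOverA P = Σ (Fin d → Fin d → List A.Carrier) λ Q → ∀ i j → P i j K-poly.≈ᴾ List.map ιA (Q i j)

  IsIntegral : Col → Set (c ⊔ ℓ₁)
  IsIntegral v = Σ (Vector A.Carrier d) λ a → v ≈ᶜ (ιA ∘ a)

{-# OPTIONS --safe #-}

-- Since Δ(σ x) = Δ(x), an element to which the formula for σ m_ℓ applies, namely
-- g^(-1) (t - θ)^(w_ℓ) m_ℓ with g ∈ A[t], has the same image under Δ as
-- g m_ℓ - (g H)^(-1) (t - θ)^(w_{ℓ-1}) m_{ℓ-1}, where H = H_{s_{ℓ-1} - 1} ∈ A[t]: the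
-- q-th roots disappear.  Dividing an element g m_ℓ repeatedly by t - θ splits off
-- multiples of the ν_i until a multiple h (t - θ)^(w_ℓ) m_ℓ remains, with h of smaller
-- degree, and h = (h^(1))^(-1); so induction on ℓ and on the degree shows that Δ maps
-- A[t] m_ℓ and these elements into A^d.  With an extra factor c ∈ K the same computation
-- expresses Δ as a polynomial in c, c^q, c^(q²), … with coefficients in A^d.  For
-- t c ν_i this gives a column of ρ_t, because a skew polynomial is determined by its
-- values on K.

module Submission where

open import Defs
open import Algebra.Bundles using (AbelianGroup; CommutativeRing)
open import Algebra.Bundles.Raw using (RawRing)
open import Algebra.Morphism.Structures using (IsRingHomomorphism; IsRingMonomorphism)
import Algebra.Apartness.Properties.HeytingCommutativeRing as HeytingProperties
import Algebra.Morphism.Construct.Composition as Composition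
import Algebra.Properties.AbelianGroup as AbelianGroupProperties
import Algebra.Properties.CommutativeSemigroup as CommutativeSemigroupProperties
import Algebra.Properties.CommutativeSemiring.Binomial as Binomial
import Algebra.Properties.CommutativeSemiring.Exp as Exponentiation
import Algebra.Properties.Ring as RingProperties
import Algebra.Properties.Semiring.Mult as Multiplication
import Algebra.Properties.Semiring.Sum as Summation
open import Data.Fin.Base as Fin using (Fin; zero; suc; toℕ; fromℕ; fromℕ<; inject₁; punchIn; _↑ˡ_; _↑ʳ_)
open import Data.Fin.Induction using (<-weakInduction)
import Data.Fin.Permutation as Permutation
import Data.Fin.Properties as Fin
open import Data.List.Base as List using (List; []; _∷_; _++_; [_]; replicate; length; lookup)
import Data.List.Properties as List
open import Data.Nat.Base as ℕ using (ℕ; zero; suc; pred; _∸_; _≤_; _<_; z≤n; s≤s)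
open import Data.Nat.Combinatorics using (_C_; nC1≡n; nCn≡1; k>n⇒nCk≡0; nCk+nC[k+1]≡[n+1]C[k+1])
open import Data.Nat.Divisibility using (_∣_; divides; >⇒∤; m∣m*n)
open import Data.Nat.Primality using (Prime; euclidsLemma; prime⇒nonTrivial)
import Data.Nat.Properties as ℕ
open import Data.Nat.Tactic.RingSolver using (solve-∀)
open import Data.Product.Base as Product using (∃-syntax; _,_; proj₁; proj₂)
open import Data.Sum.Base using (inj₁; inj₂; [_,_]′)
open import Data.Vec.Functional using (Vector; init; last; tail)
open import Function.Base using (_∘_; id)
open import Function.Bundles using (Inverse)
open import Level using (_⊔_)
open import Relation.Binary.Definitions using (tri<; tri≈; tri>)
open import Relation.Binary.PropositionalEquality as ≡ using (_≡_; _≢_)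
import Relation.Binary.Reasoning.Setoid as SetoidReasoning
open import Relation.Nullary.Decidable using (yes; no)
open import Relation.Nullary.Negation using (¬_; contradiction)

-- An apparent circularity shapes the argument. Integrality for h (t - θ)^(w_ℓ) m_ℓ rests on the
-- formula for σ m_ℓ, applied to h^(1), and this leads back to h^(1) m_ℓ, whose degree is that of h.
-- One division by t - θ lowers the degree before the recursion is entered. For the same reason the
-- induction on ℓ carries an implication, from `low ℓ 0 g` to `high ℓ g`, whose premise is supplied
-- by the induction on the degree at the same ℓ. Nothing leaves A on the way: t - θ is monic, h^(1)
-- has the q-th powers of the coefficients of h, and H is given over A. The scalar c is carried
-- along because c = (c^q)^(1/q): each passage from h to h^(1) also replaces c by c^q, which
-- multiplies the skew polynomials in A[τ] by τ on the right. The special point is a value at c = 1.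
-- That values on K determine a skew polynomial comes from θ being transcendental over the finite
-- field: the maps x ↦ x^(q^i) take different values at θ.

-- The commutative ring of polynomials.

module PolynomialRing {c ℓ} (R : CommutativeRing c ℓ) where
  open CommutativeRing R
  open Polynomials rawRing
  open RingProperties ring using (-0#≈0#)

  -- A record, so that the polynomials can be inferred from a proof of their equality.
  infix 4 _≋_
  record _≋_ (f g : List Carrier) : Set ℓ where
    constructor pointwise
    field at : f ≈ᴾ g
  open _≋_ public

  -ᴾ_ : List Carrier → List Carrier
  -ᴾ_ = List.map (-_)

  coeff-+ : ∀ f g n → coeff (f +ᴾ g) n ≈ coeff f n + coeff g n
  coeff-+ []      g       n       = sym (+-identityˡ _)
  coeff-+ (a ∷ f) []      n       = sym (+-identityʳ _)
  coeff-+ (a ∷ f) (b ∷ g) zero    = refl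
  coeff-+ (a ∷ f) (b ∷ g) (suc n) = coeff-+ f g n

  coeff-· : ∀ a f n → coeff (a ·ᴾ f) n ≈ a * coeff f n
  coeff-· a []      n       = sym (zeroʳ a)
  coeff-· a (b ∷ f) zero    = refl
  coeff-· a (b ∷ f) (suc n) = coeff-· a f n

  coeff-neg : ∀ f n → coeff (-ᴾ f) n ≈ - coeff f n
  coeff-neg []      n       = sym -0#≈0#
  coeff-neg (b ∷ f) zero    = refl
  coeff-neg (b ∷ f) (suc n) = coeff-neg f n

  ∷-cong : ∀ {a b f g} → a ≈ b → f ≋ g → a ∷ f ≋ b ∷ g
  ∷-cong a≈b f≈g .at zero    = a≈b
  ∷-cong a≈b f≈g .at (suc n) = f≈g .at n

  0∷[]≋[] : 0# ∷ [] ≋ []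
  0∷[]≋[] .at zero    = refl
  0∷[]≋[] .at (suc n) = refl

  +ᴾ-cong : ∀ {f f′ g g′} → f ≋ f′ → g ≋ g′ → f +ᴾ g ≋ f′ +ᴾ g′
  +ᴾ-cong {f} {f′} {g} {g′} p q .at n =
    trans (coeff-+ f g n) (trans (+-cong (p .at n) (q .at n)) (sym (coeff-+ f′ g′ n)))

  ·ᴾ-cong : ∀ {a b f g} → a ≈ b → f ≋ g → a ·ᴾ f ≋ b ·ᴾ g
  ·ᴾ-cong {a} {b} {f} {g} p q .at n =
    trans (coeff-· a f n) (trans (*-cong p (q .at n)) (sym (coeff-· b g n)))

  +ᴾ-assoc : ∀ f g h → (f +ᴾ g) +ᴾ h ≋ f +ᴾ (g +ᴾ h)
  +ᴾ-assoc f g h .at n = begin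
    coeff (f +ᴾ g +ᴾ h) n                  ≈⟨ coeff-+ (f +ᴾ g) h n ⟩
    coeff (f +ᴾ g) n + coeff h n           ≈⟨ +-congʳ (coeff-+ f g n) ⟩
    coeff f n + coeff g n + coeff h n      ≈⟨ +-assoc _ _ _ ⟩
    coeff f n + (coeff g n + coeff h n)    ≈⟨ +-congˡ (coeff-+ g h n) ⟨
    coeff f n + coeff (g +ᴾ h) n           ≈⟨ coeff-+ f (g +ᴾ h) n ⟨
    coeff (f +ᴾ (g +ᴾ h)) n                ∎
    where open SetoidReasoning setoid

  +ᴾ-abelianGroup : AbelianGroup c ℓ
  +ᴾ-abelianGroup = record
    { Carrier = List Carrier
    ; _≈_ = _≋_
    ; _∙_ = _+ᴾ_
    ; ε = []
    ; _⁻¹ = -ᴾ_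
    ; isAbelianGroup = record
      { isGroup = record
        { isMonoid = record
          { isSemigroup = record
            { isMagma = record
              { isEquivalence = record
                { refl  = pointwise λ n → refl
                ; sym   = λ p → pointwise λ n → sym (p .at n)
                ; trans = λ p q → pointwise λ n → trans (p .at n) (q .at n)
                }
              ; ∙-cong = +ᴾ-cong
              }
            ; assoc = +ᴾ-assoc
            }
          ; identity = (λ f → pointwise λ n → refl)
                     , (λ f → pointwise λ n → trans (coeff-+ f [] n) (+-identityʳ _))
          }
        ; inverse = (λ f → pointwise λ n → trans (coeff-+ (-ᴾ f) f n)
                      (trans (+-congʳ (coeff-neg f n)) (-‿inverseˡ _)))
                  , (λ f → pointwise λ n → trans (coeff-+ f (-ᴾ f) n)
                      (trans (+-congˡ (coeff-neg f n)) (-‿inverseʳ _)))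
        ; ⁻¹-cong = λ {f} {g} p → pointwise λ n →
            trans (coeff-neg f n) (trans (-‿cong (p .at n)) (sym (coeff-neg g n)))
        }
      ; comm = λ f g → pointwise λ n →
          trans (coeff-+ f g n) (trans (+-comm _ _) (sym (coeff-+ g f n)))
      }
    }

  private
    module + where
      open AbelianGroup +ᴾ-abelianGroup public
      open CommutativeSemigroupProperties commutativeSemigroup public
        using (interchange; x∙yz≈y∙xz)

  open SetoidReasoning +.setoid

  0∷-+ : ∀ f g → 0# ∷ (f +ᴾ g) ≋ (0# ∷ f) +ᴾ (0# ∷ g)
  0∷-+ f g = ∷-cong (sym (+-identityˡ 0#)) +.refl

  ·ᴾ-distribˡ : ∀ a f g → a ·ᴾ (f +ᴾ g) ≋ a ·ᴾ f +ᴾ a ·ᴾ g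
  ·ᴾ-distribˡ a f g .at n =
    trans (coeff-· a (f +ᴾ g) n) (trans (*-congˡ (coeff-+ f g n)) (trans (distribˡ a _ _)
      (sym (trans (coeff-+ (a ·ᴾ f) (a ·ᴾ g) n) (+-cong (coeff-· a f n) (coeff-· a g n))))))

  ·ᴾ-assoc : ∀ a b f → (a * b) ·ᴾ f ≋ a ·ᴾ (b ·ᴾ f)
  ·ᴾ-assoc a b f .at n =
    trans (coeff-· (a * b) f n) (trans (*-assoc a b _)
      (sym (trans (coeff-· a (b ·ᴾ f) n) (*-congˡ (coeff-· b f n)))))

  1·ᴾ : ∀ f → 1# ·ᴾ f ≋ f
  1·ᴾ f .at n = trans (coeff-· 1# f n) (*-identityˡ _)

  0·ᴾ : ∀ f → 0# ·ᴾ f ≋ []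
  0·ᴾ f .at n = trans (coeff-· 0# f n) (zeroˡ _)

  const-* : ∀ a f → const a *ᴾ f ≋ a ·ᴾ f
  const-* a f = +.trans (+.∙-congˡ 0∷[]≋[]) (+.identityʳ _)

  0∷-* : ∀ f g → (0# ∷ f) *ᴾ g ≋ 0# ∷ (f *ᴾ g)
  0∷-* f g = +.∙-congʳ (0·ᴾ g)

  *ᴾ-congˡ : ∀ f {g h} → g ≋ h → f *ᴾ g ≋ f *ᴾ h
  *ᴾ-congˡ []      p = +.refl
  *ᴾ-congˡ (a ∷ f) p = +.∙-cong (·ᴾ-cong refl p) (∷-cong refl (*ᴾ-congˡ f p))

  *ᴾ-zeroʳ : ∀ f → f *ᴾ [] ≋ []
  *ᴾ-zeroʳ []      = +.refl
  *ᴾ-zeroʳ (a ∷ f) = +.trans (∷-cong refl (*ᴾ-zeroʳ f)) 0∷[]≋[]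

  -- Multiplication recurses on its left factor; this is the mirrored recursion on the right factor,
  -- from which commutativity follows by induction.
  *ᴾ-∷ : ∀ f b g → f *ᴾ (b ∷ g) ≋ b ·ᴾ f +ᴾ (0# ∷ f *ᴾ g)
  *ᴾ-∷ []      b g = +.sym 0∷[]≋[]
  *ᴾ-∷ (a ∷ f) b g = ∷-cong (+-congʳ (*-comm a b)) (begin
    a ·ᴾ g +ᴾ f *ᴾ (b ∷ g)               ≈⟨ +.∙-congˡ (*ᴾ-∷ f b g) ⟩
    a ·ᴾ g +ᴾ (b ·ᴾ f +ᴾ (0# ∷ f *ᴾ g))  ≈⟨ +.x∙yz≈y∙xz (a ·ᴾ g) (b ·ᴾ f) _ ⟩
    b ·ᴾ f +ᴾ (a ·ᴾ g +ᴾ (0# ∷ f *ᴾ g))  ∎)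

  *ᴾ-comm : ∀ f g → f *ᴾ g ≋ g *ᴾ f
  *ᴾ-comm f []      = *ᴾ-zeroʳ f
  *ᴾ-comm f (b ∷ g) = +.trans (*ᴾ-∷ f b g) (+.∙-congˡ (∷-cong refl (*ᴾ-comm f g)))

  *ᴾ-congʳ : ∀ {f g} h → f ≋ g → f *ᴾ h ≋ g *ᴾ h
  *ᴾ-congʳ {f} {g} h p = +.trans (*ᴾ-comm f h) (+.trans (*ᴾ-congˡ h p) (*ᴾ-comm h g))

  *ᴾ-distribˡ : ∀ f g h → f *ᴾ (g +ᴾ h) ≋ f *ᴾ g +ᴾ f *ᴾ h
  *ᴾ-distribˡ []      g h = +.refl
  *ᴾ-distribˡ (a ∷ f) g h = begin
    a ·ᴾ (g +ᴾ h) +ᴾ (0# ∷ f *ᴾ (g +ᴾ h))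
      ≈⟨ +.∙-cong (·ᴾ-distribˡ a g h) (+.trans (∷-cong refl (*ᴾ-distribˡ f g h)) (0∷-+ (f *ᴾ g) (f *ᴾ h))) ⟩
    (a ·ᴾ g +ᴾ a ·ᴾ h) +ᴾ ((0# ∷ f *ᴾ g) +ᴾ (0# ∷ f *ᴾ h))
      ≈⟨ +.interchange (a ·ᴾ g) (a ·ᴾ h) (0# ∷ f *ᴾ g) (0# ∷ f *ᴾ h) ⟩
    (a ∷ f) *ᴾ g +ᴾ (a ∷ f) *ᴾ h ∎

  *ᴾ-distribʳ : ∀ h f g → (f +ᴾ g) *ᴾ h ≋ f *ᴾ h +ᴾ g *ᴾ h
  *ᴾ-distribʳ h f g = +.trans (*ᴾ-comm (f +ᴾ g) h)
    (+.trans (*ᴾ-distribˡ h f g) (+.∙-cong (*ᴾ-comm h f) (*ᴾ-comm h g)))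

  ·ᴾ-* : ∀ a f g → (a ·ᴾ f) *ᴾ g ≋ a ·ᴾ (f *ᴾ g)
  ·ᴾ-* a []      g = +.refl
  ·ᴾ-* a (b ∷ f) g = begin
    (a * b) ·ᴾ g +ᴾ (0# ∷ (a ·ᴾ f) *ᴾ g)
      ≈⟨ +.∙-cong (·ᴾ-assoc a b g) (∷-cong (sym (zeroʳ a)) (·ᴾ-* a f g)) ⟩
    a ·ᴾ (b ·ᴾ g) +ᴾ a ·ᴾ (0# ∷ f *ᴾ g)
      ≈⟨ ·ᴾ-distribˡ a (b ·ᴾ g) (0# ∷ f *ᴾ g) ⟨
    a ·ᴾ ((b ∷ f) *ᴾ g) ∎

  *ᴾ-assoc : ∀ f g h → (f *ᴾ g) *ᴾ h ≋ f *ᴾ (g *ᴾ h)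
  *ᴾ-assoc []      g h = +.refl
  *ᴾ-assoc (a ∷ f) g h = begin
    (a ·ᴾ g +ᴾ (0# ∷ f *ᴾ g)) *ᴾ h          ≈⟨ *ᴾ-distribʳ h (a ·ᴾ g) (0# ∷ f *ᴾ g) ⟩
    (a ·ᴾ g) *ᴾ h +ᴾ (0# ∷ f *ᴾ g) *ᴾ h     ≈⟨ +.∙-cong (·ᴾ-* a g h) (0∷-* (f *ᴾ g) h) ⟩
    a ·ᴾ (g *ᴾ h) +ᴾ (0# ∷ (f *ᴾ g) *ᴾ h)   ≈⟨ +.∙-congˡ (∷-cong refl (*ᴾ-assoc f g h)) ⟩
    (a ∷ f) *ᴾ (g *ᴾ h)                     ∎

  polynomialRing : CommutativeRing c ℓ
  polynomialRing = record
    { Carrier = List Carrier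
    ; _≈_ = _≋_
    ; _+_ = _+ᴾ_
    ; _*_ = _*ᴾ_
    ; -_  = -ᴾ_
    ; 0#  = []
    ; 1#  = const 1#
    ; isCommutativeRing = record
      { isRing = record
        { +-isAbelianGroup = +.isAbelianGroup
        ; *-cong = λ {f} {g} {h} {k} p q → +.trans (*ᴾ-congʳ h p) (*ᴾ-congˡ g q)
        ; *-assoc = *ᴾ-assoc
        ; *-identity = (λ f → +.trans (const-* 1# f) (1·ᴾ f))
                     , (λ f → +.trans (*ᴾ-comm f (const 1#)) (+.trans (const-* 1# f) (1·ᴾ f)))
        ; distrib = *ᴾ-distribˡ , *ᴾ-distribʳ
        }
      ; *-comm = *ᴾ-comm
      }
    }

-- Additivity of Frobenius in characteristic p.

-- The absorption identity, obtained from Pascal's rule. For n + 1 prime its right side is visibly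
-- divisible by that prime.
[1+k]*[1+n]C[1+k] : ∀ n k → suc k ℕ.* (suc n C suc k) ≡ suc n ℕ.* (n C k)
[1+k]*[1+n]C[1+k] zero zero = ≡.refl
[1+k]*[1+n]C[1+k] zero (suc k)
  rewrite k>n⇒nCk≡0 {1} {suc (suc k)} (ℕ.s≤s (ℕ.s≤s ℕ.z≤n)) = ℕ.*-zeroʳ (suc (suc k))
[1+k]*[1+n]C[1+k] (suc n) zero
  rewrite nC1≡n (suc (suc n)) = ≡.trans (ℕ.*-identityˡ _) (≡.sym (ℕ.*-identityʳ _))
[1+k]*[1+n]C[1+k] (suc n) (suc k) = begin
  suc (suc k) ℕ.* (suc (suc n) C suc (suc k))
    ≡⟨ ≡.cong (suc (suc k) ℕ.*_) (nCk+nC[k+1]≡[n+1]C[k+1] (suc n) (suc k)) ⟨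
  suc (suc k) ℕ.* (a ℕ.+ b)
    ≡⟨ regroup k a b ⟩
  suc k ℕ.* a ℕ.+ a ℕ.+ suc (suc k) ℕ.* b
    ≡⟨ ≡.cong₂ (λ x y → x ℕ.+ a ℕ.+ y) ([1+k]*[1+n]C[1+k] n k) ([1+k]*[1+n]C[1+k] n (suc k)) ⟩
  suc n ℕ.* (n C k) ℕ.+ a ℕ.+ suc n ℕ.* (n C suc k)
    ≡⟨ collect n a (n C k) (n C suc k) ⟩
  a ℕ.+ suc n ℕ.* (n C k ℕ.+ n C suc k)
    ≡⟨ ≡.cong (λ x → a ℕ.+ suc n ℕ.* x) (nCk+nC[k+1]≡[n+1]C[k+1] n k) ⟩
  suc (suc n) ℕ.* a ∎
  where
  open ≡.≡-Reasoning
  a = suc n C suc k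
  b = suc n C suc (suc k)

  regroup : ∀ k a b → suc (suc k) ℕ.* (a ℕ.+ b) ≡ suc k ℕ.* a ℕ.+ a ℕ.+ suc (suc k) ℕ.* b
  regroup = solve-∀

  collect : ∀ n a c e → suc n ℕ.* c ℕ.+ a ℕ.+ suc n ℕ.* e ≡ a ℕ.+ suc n ℕ.* (c ℕ.+ e)
  collect = solve-∀

-- By absorption the prime divides (k + 1) times the binomial coefficient, and it is too large to
-- divide k + 1.
prime∣C : ∀ {n k} → Prime (suc n) → suc k ℕ.< suc n → suc n ∣ suc n C suc k
prime∣C {n} {k} p-prime k<n
  with euclidsLemma (suc k) (suc n C suc k) p-prime
         (≡.subst (suc n ∣_) (≡.sym ([1+k]*[1+n]C[1+k] n k)) (m∣m*n (n C k)))
... | inj₁ p∣k = contradiction p∣k (>⇒∤ k<n)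
... | inj₂ p∣C = p∣C

module SumProperties {c ℓ} (R : CommutativeRing c ℓ) where
  open CommutativeRing R hiding (zero)
  open Summation semiring

  sum-zero : ∀ {n} (f : Fin n → Carrier) → (∀ i → f i ≈ 0#) → sum f ≈ 0#
  sum-zero {n} f f≈0 = trans (sum-cong-≋ f≈0) (sum-replicate-zero n)

  sum-single : ∀ {n} (i : Fin n) (f : Fin n → Carrier) → (∀ j → i ≢ j → f j ≈ 0#) → sum f ≈ f i
  sum-single {suc n} i f f≈0 = trans (sum-remove f)
    (trans (+-congˡ (sum-zero _ λ j → f≈0 (punchIn i j) (Fin.punchInᵢ≢i i j ∘ ≡.sym))) (+-identityʳ _))

  module _ {n} (f g h : Fin n → Carrier) where

    sum-*-congʳ : (∀ i → f i ≈ g i) → sum (λ i → f i * h i) ≈ sum (λ i → g i * h i)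
    sum-*-congʳ f≈g = sum-cong-≋ {n} λ i → *-congʳ (f≈g i)

    sum-*-congˡ : (∀ i → f i ≈ g i) → sum (λ i → h i * f i) ≈ sum (λ i → h i * g i)
    sum-*-congˡ f≈g = sum-cong-≋ {n} λ i → *-congˡ (f≈g i)

    sum-*-+ : sum (λ i → (f i + g i) * h i) ≈ sum (λ i → f i * h i) + sum (λ i → g i * h i)
    sum-*-+ = trans (sum-cong-≋ {n} λ i → distribʳ (h i) (f i) (g i)) (∑-distrib-+ {n} _ _)

  sum-*-assoc : ∀ {n} a (f h : Fin n → Carrier) → sum (λ i → a * f i * h i) ≈ a * sum (λ i → f i * h i)
  sum-*-assoc {n} a f h = trans (sum-cong-≋ {n} λ i → *-assoc a (f i) (h i))
    (sym (*-distribˡ-sum a λ i → f i * h i))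

module Characteristic {c ℓ} (R : CommutativeRing c ℓ) where
  open CommutativeRing R hiding (zero)
  open Exponentiation commutativeSemiring
  open Multiplication semiring
  open Summation semiring using (sum; sum-init-last)
  open SumProperties R using (sum-zero)
  open SetoidReasoning setoid

  1^ : ∀ n → 1# ^ n ≈ 1#
  1^ zero    = refl
  1^ (suc n) = trans (*-identityˡ _) (1^ n)

  ×-multiple≈0 : ∀ {p} → p × 1# ≈ 0# → ∀ {n} → p ∣ n → ∀ x → n × x ≈ 0#
  ×-multiple≈0 {p} p×1≈0 (divides m ≡.refl) x = begin
    (m ℕ.* p) × x     ≈⟨ ×-congʳ (m ℕ.* p) (*-identityˡ x) ⟨
    (m ℕ.* p) × (1# * x)  ≈⟨ ×-assoc-* (m ℕ.* p) 1# x ⟨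
    (m ℕ.* p) × 1# * x    ≈⟨ *-congʳ (×-assocˡ 1# m p) ⟨
    m × (p × 1#) * x      ≈⟨ *-congʳ (×-congʳ m p×1≈0) ⟩
    m × 0# * x            ≈⟨ ×-assoc-* m 0# x ⟩
    m × (0# * x)          ≈⟨ ×-comm-* m 0# x ⟨
    0# * (m × x)          ≈⟨ zeroˡ _ ⟩
    0#                    ∎

  -- Only the two extreme terms of the binomial expansion survive. The term of index 0 is the power
  -- of y and the last one the power of x, hence the final exchange.
  +-^p : ∀ {p} → Prime p → p × 1# ≈ 0# → ∀ x y → (x + y) ^ p ≈ x ^ p + y ^ p
  +-^p {suc n} p-prime p×1≈0 x y = begin
    (x + y) ^ suc n               ≈⟨ theorem (suc n) x y ⟩
    T zero + sum (T ∘ suc)        ≈⟨ +-cong first (sum-init-last (T ∘ suc)) ⟩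
    y ^ suc n + (sum (init (T ∘ suc)) + last (T ∘ suc))
      ≈⟨ +-congˡ (+-cong (sum-zero (init (T ∘ suc)) middle) final) ⟩
    y ^ suc n + (0# + x ^ suc n)  ≈⟨ +-congˡ (+-identityˡ _) ⟩
    y ^ suc n + x ^ suc n         ≈⟨ +-comm _ _ ⟩
    x ^ suc n + y ^ suc n         ∎
    where
    open Binomial commutativeSemiring using (theorem; binomialTerm)
    T : Fin (suc (suc n)) → Carrier
    T = binomialTerm x y (suc n)

    first : T zero ≈ y ^ suc n
    first = trans (+-identityʳ _) (*-identityˡ _)

    middle : ∀ i → init (T ∘ suc) i ≈ 0#
    middle i = ×-multiple≈0 p×1≈0
      (prime∣C p-prime (≡.subst (λ k → suc k ℕ.< suc n) (≡.sym (Fin.toℕ-inject₁ i)) (ℕ.s≤s (Fin.toℕ<n i)))) _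

    final : last (T ∘ suc) ≈ x ^ suc n
    final rewrite Fin.toℕ-fromℕ n | nCn≡1 (suc n) | ℕ.n∸n≡0 n =
      trans (+-identityʳ _) (*-identityʳ _)

  +-^p^ : ∀ {p} → Prime p → p × 1# ≈ 0# → ∀ e x y →
          (x + y) ^ (p ℕ.^ e) ≈ x ^ (p ℕ.^ e) + y ^ (p ℕ.^ e)
  +-^p^     p-prime p×1≈0 zero    x y = distribʳ 1# x y
  +-^p^ {p} p-prime p×1≈0 (suc e) x y = begin
    (x + y) ^ (p ℕ.* p ℕ.^ e)                      ≈⟨ ^-assocʳ (x + y) p (p ℕ.^ e) ⟨
    ((x + y) ^ p) ^ (p ℕ.^ e)                      ≈⟨ ^-congˡ (p ℕ.^ e) (+-^p p-prime p×1≈0 x y) ⟩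
    (x ^ p + y ^ p) ^ (p ℕ.^ e)                    ≈⟨ +-^p^ p-prime p×1≈0 e (x ^ p) (y ^ p) ⟩
    (x ^ p) ^ (p ℕ.^ e) + (y ^ p) ^ (p ℕ.^ e)      ≈⟨ +-cong (^-assocʳ x p (p ℕ.^ e)) (^-assocʳ y p (p ℕ.^ e)) ⟩
    x ^ (p ℕ.* p ℕ.^ e) + y ^ (p ℕ.* p ℕ.^ e)      ∎

-- Discrete fields: nilpotents, zero divisors, characteristic.

module FieldProperties {c ℓ₁ ℓ₂} (F : DiscreteField c ℓ₁ ℓ₂) where
  open DiscreteField F hiding (zero)
  open CommutativeRing commutativeRing using (+-abelianGroup; semiring; commutativeSemiring)
  open HeytingProperties heytingCommutativeRing using (x#0y#0→xy#0; 1#0)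
  open Exponentiation commutativeSemiring
  open Multiplication semiring
  open Summation semiring
  open AbelianGroupProperties +-abelianGroup using (identityʳ-unique)
  open SetoidReasoning setoid

  ^≈0⇒≈0 : ∀ n {x} → x ^ n ≈ 0# → x ≈ 0#
  ^≈0⇒≈0 n {x} xⁿ≈0 with x #? 0#
  ... | no ¬x#0 = proj₁ (tight x 0#) ¬x#0
  ... | yes x#0 = contradiction (power n) (proj₂ (tight _ _) xⁿ≈0)
    where
    power : ∀ n → x ^ n # 0#
    power zero    = 1#0
    power (suc n) = x#0y#0→xy#0 x#0 (power n)

  *-cancel-zero : ∀ {x y} → ¬ (y ≈ 0#) → x * y ≈ 0# → x ≈ 0#
  *-cancel-zero {x} {y} y≉0 xy≈0 with x #? 0# | y #? 0#
  ... | no ¬x#0 | _       = proj₁ (tight x 0#) ¬x#0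
  ... | yes x#0 | no ¬y#0 = contradiction (proj₁ (tight y 0#) ¬y#0) y≉0
  ... | yes x#0 | yes y#0 = contradiction (x#0y#0→xy#0 x#0 y#0) (proj₂ (tight _ _) xy≈0)

  module _ {n} (card : Inverse setoid (≡.setoid (Fin n))) where
    open Inverse card

    -- Translation by 1 permutes the n elements, so their sum S satisfies S = S + n × 1.
    cardinality×1≈0 : n × 1# ≈ 0#
    cardinality×1≈0 = identityʳ-unique (sum from) (n × 1#) (begin
      sum from + n × 1#               ≈⟨ +-congˡ (sum-replicate n) ⟨
      sum from + sum {n} (λ _ → 1#)   ≈⟨ ∑-distrib-+ from (λ _ → 1#) ⟨
      sum (λ i → from i + 1#)         ≈⟨ sum-cong-≋ {n} (λ i → inverseʳ ≡.refl) ⟨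
      sum (λ i → from (to (from i + 1#))) ≈⟨ sum-permute from translation ⟨
      sum from                        ∎)
      where
      cancel : ∀ {y z} → y + z ≈ 0# → ∀ i → to (from (to (from i + z)) + y) ≡ i
      cancel {y} {z} y+z≈0 i = inverseˡ (begin
        from (to (from i + z)) + y  ≈⟨ +-congʳ (inverseʳ ≡.refl) ⟩
        from i + z + y              ≈⟨ +-assoc _ _ _ ⟩
        from i + (z + y)            ≈⟨ +-congˡ (trans (+-comm z y) y+z≈0) ⟩
        from i + 0#                 ≈⟨ +-identityʳ _ ⟩
        from i                      ∎)

      translation : Permutation.Permutation′ n
      translation = Permutation.permutation
        (λ i → to (from i + 1#)) (λ i → to (from i + - 1#))
        (cancel (-‿inverseʳ 1#)) (cancel (-‿inverseˡ 1#))

  -- The cardinality kills only p^e; since (p × 1)^e = p^e × 1 and a field has no nilpotents, p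
  -- itself vanishes.
  characteristic : ∀ p e → Inverse setoid (≡.setoid (Fin (p ℕ.^ e))) → p × 1# ≈ 0#
  characteristic p e card = ^≈0⇒≈0 e (trans (power e) (cardinality×1≈0 card))
    where
    power : ∀ e → (p × 1#) ^ e ≈ (p ℕ.^ e) × 1#
    power zero    = sym (+-identityʳ 1#)
    power (suc e) = begin
      p × 1# * (p × 1#) ^ e        ≈⟨ *-congˡ (power e) ⟩
      p × 1# * (p ℕ.^ e) × 1#      ≈⟨ ×1-homo-* p (p ℕ.^ e) ⟨
      (p ℕ.* p ℕ.^ e) × 1#         ∎

-- Coefficientwise maps and monomials.

-- Serves two homomorphisms: the q-th root on K, which yields the twist f ↦ f^(-1), and the
-- embedding `ιA` of A into K.
module PolynomialMap {c ℓ c′ ℓ′} (R : RawRing c ℓ) (S : CommutativeRing c′ ℓ′)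
         {φ : RawRing.Carrier R → CommutativeRing.Carrier S}
         (φ-homo : IsRingHomomorphism R (CommutativeRing.rawRing S) φ) where
  private module R[t] = Polynomials R
  open CommutativeRing S hiding (zero)
  open Polynomials rawRing
  open PolynomialRing S
  open CommutativeRing polynomialRing using () renaming (refl to ≋-refl; trans to ≋-trans; +-cong to ≋-+-cong)
  open IsRingHomomorphism φ-homo

  coeff-map : ∀ f n → coeff (List.map φ f) n ≈ φ (R[t].coeff f n)
  coeff-map []      n       = sym 0#-homo
  coeff-map (a ∷ f) zero    = refl
  coeff-map (a ∷ f) (suc n) = coeff-map f n

  map-cong : ∀ {f g} → f R[t].≈ᴾ g → List.map φ f ≋ List.map φ g
  map-cong {f} {g} f≈g .at n =
    trans (coeff-map f n) (trans (⟦⟧-cong (f≈g n)) (sym (coeff-map g n)))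

  map-+ : ∀ f g → List.map φ (f R[t].+ᴾ g) ≋ List.map φ f +ᴾ List.map φ g
  map-+ []      g       = ≋-refl
  map-+ (a ∷ f) []      = ≋-refl
  map-+ (a ∷ f) (b ∷ g) = ∷-cong (+-homo a b) (map-+ f g)

  map-· : ∀ a f → List.map φ (a R[t].·ᴾ f) ≋ φ a ·ᴾ List.map φ f
  map-· a []      = ≋-refl
  map-· a (b ∷ f) = ∷-cong (*-homo a b) (map-· a f)

  map-* : ∀ f g → List.map φ (f R[t].*ᴾ g) ≋ List.map φ f *ᴾ List.map φ g
  map-* []      g = ≋-refl
  map-* (a ∷ f) g = ≋-trans (map-+ (a R[t].·ᴾ g) _)
    (≋-+-cong (map-· a g) (∷-cong 0#-homo (map-* f g)))

  map-neg : ∀ f → List.map φ (List.map (RawRing.-_ R) f) ≋ -ᴾ List.map φ f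
  map-neg []      = ≋-refl
  map-neg (a ∷ f) = ∷-cong (-‿homo a) (map-neg f)

module Monomials {c ℓ} (R : CommutativeRing c ℓ) where
  open CommutativeRing R hiding (zero)
  open PolynomialRing R
  open Polynomials rawRing
  private module R[t] = Ops (Poly rawRing)

  -- Unfolds to the same list as the local polynomial inside `qth-root`, so the root equation there
  -- can be restated with `monomial`.
  monomial : ℕ → List Carrier
  monomial n = replicate n 0# ++ [ 1# ]

  X*-shift : ∀ f → X *ᴾ f ≋ 0# ∷ f
  X*-shift f = T.trans (0∷-* (const 1#) f) (∷-cong refl (T.*-identityˡ f))
    where module T = CommutativeRing polynomialRing

  X^≋monomial : ∀ n → X R[t].^ n ≋ monomial n
  X^≋monomial zero    = CommutativeRing.refl polynomialRing
  X^≋monomial (suc n) = T.trans (X*-shift (X R[t].^ n)) (∷-cong refl (X^≋monomial n))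
    where module T = CommutativeRing polynomialRing

  coeff-monomial : ∀ n → coeff (monomial n) n ≡ 1#
  coeff-monomial zero    = ≡.refl
  coeff-monomial (suc n) = coeff-monomial n

  coeff-monomial-≢ : ∀ n m → n ≢ m → coeff (monomial n) m ≡ 0#
  coeff-monomial-≢ zero    zero    n≢m = contradiction ≡.refl n≢m
  coeff-monomial-≢ zero    (suc m) n≢m = ≡.refl
  coeff-monomial-≢ (suc n) zero    n≢m = ≡.refl
  coeff-monomial-≢ (suc n) (suc m) n≢m = coeff-monomial-≢ n m (n≢m ∘ ≡.cong suc)

  X^-injective : ¬ (1# ≈ 0#) → ∀ {n m} → X R[t].^ n ≈ᴾ X R[t].^ m → n ≡ m
  X^-injective 1≉0 {n} {m} Xⁿ≈Xᵐ with n ℕ.≟ m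
  ... | yes n≡m = n≡m
  ... | no  n≢m = contradiction (begin
    1#                       ≡⟨ coeff-monomial n ⟨
    coeff (monomial n) n     ≈⟨ X^≋monomial n .at n ⟨
    coeff (X R[t].^ n) n     ≈⟨ Xⁿ≈Xᵐ n ⟩
    coeff (X R[t].^ m) n     ≈⟨ X^≋monomial m .at n ⟩
    coeff (monomial m) n     ≡⟨ coeff-monomial-≢ m n (n≢m ∘ ≡.sym) ⟩
    0#                       ∎) 1≉0
    where open SetoidReasoning setoid

  eval-monomial : ∀ n x → eval (monomial n) x ≈ Ops._^_ rawRing x n
  eval-monomial zero    x = trans (+-congˡ (zeroʳ x)) (+-identityʳ 1#)
  eval-monomial (suc n) x = trans (+-identityˡ _) (*-congˡ (eval-monomial n x))

-- Frobenius and q-th roots on K.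

module ScalarProperties {c ℓ₁ ℓ₂} (B : BaseData c ℓ₁ ℓ₂) where
  open BaseData B
  open Scalars B using (K-raw; ιA; ι𝔽; θ; frob; qth-root; evalᵀ)
  private
    module 𝔽 = DiscreteField 𝔽
    module A = Ops A

  K-ring : CommutativeRing c ℓ₁
  K-ring = DiscreteField.commutativeRing K

  open CommutativeRing K-ring hiding (zero)
  open Polynomials K-raw
  open PolynomialRing K-ring
  open Exponentiation commutativeSemiring
  open Multiplication semiring using (_×_)
  open Characteristic K-ring using (1^; +-^p^)
  open FieldProperties K using (^≈0⇒≈0; *-cancel-zero)
  open RingProperties ring using (-‿+-comm; -‿distribʳ-*; -0#≈0#; [y-z]x≈yx-zx)
  open AbelianGroupProperties +-abelianGroup using (inverseˡ-unique; inverseʳ-unique; x∙y⁻¹≈ε⇒x≈y; identityʳ-unique)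
  open CommutativeSemigroupProperties +-commutativeSemigroup using (interchange)
  open CommutativeSemigroupProperties *-commutativeSemigroup using (x∙yz≈y∙xz)
  open SetoidReasoning setoid

  ιA-mono : IsRingMonomorphism A K-raw ιA
  ιA-mono = Composition.isRingMonomorphism trans
    (IsFractionField.isRingMonomorphism k-frac) (IsAlgebraicClosure.isRingMonomorphism K-alg)

  module ιA = IsRingMonomorphism ιA-mono

  ιA-^ : ∀ a n → ιA (a A.^ n) ≈ ιA a ^ n
  ιA-^ a zero    = ιA.1#-homo
  ιA-^ a (suc n) = trans (ιA.*-homo a _) (*-congˡ (ιA-^ a n))

  -- Distinct powers of the variable already differ in A, and `ιA` is injective. Later this makes θ
  -- separate the powers of Frobenius.
  θ^-injective : ∀ {i j} → θ ^ i ≈ θ ^ j → i ≡ j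
  θ^-injective {i} {j} θⁱ≈θʲ = Monomials.X^-injective 𝔽.commutativeRing 𝔽.1≉0
    (ιA.injective (trans (ιA-^ _ i) (trans θⁱ≈θʲ (sym (ιA-^ _ j)))))

  p×1≈0 : p × 1# ≈ 0#
  p×1≈0 = begin
    p × 1#             ≈⟨ ι𝔽-× p ⟨
    ι𝔽 (p 𝔽×.× 𝔽.1#)   ≈⟨ ι𝔽-cong (FieldProperties.characteristic 𝔽 p e 𝔽-card) ⟩
    ι𝔽 𝔽.0#            ≈⟨ ι𝔽-0 ⟩
    0#                 ∎
    where
    module 𝔽×  = Multiplication (CommutativeRing.semiring 𝔽.commutativeRing)
    module 𝔽[θ] = PolynomialRing 𝔽.commutativeRing

    ι𝔽-cong : ∀ {a b} → a 𝔽.≈ b → ι𝔽 a ≈ ι𝔽 b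
    ι𝔽-cong a≈b = ιA.⟦⟧-cong (𝔽[θ].at (𝔽[θ].∷-cong a≈b (𝔽[θ].pointwise λ _ → 𝔽.refl)))

    ι𝔽-0 : ι𝔽 𝔽.0# ≈ 0#
    ι𝔽-0 = trans (ιA.⟦⟧-cong (𝔽[θ].at 𝔽[θ].0∷[]≋[])) ιA.0#-homo

    ι𝔽-× : ∀ n → ι𝔽 (n 𝔽×.× 𝔽.1#) ≈ n × 1#
    ι𝔽-× zero    = ι𝔽-0
    ι𝔽-× (suc n) = trans (ιA.+-homo _ _) (+-cong ιA.1#-homo (ι𝔽-× n))

  frob-cong : ∀ i {x y} → x ≈ y → frob i x ≈ frob i y
  frob-cong i = ^-congˡ (q ℕ.^ i)

  frob-* : ∀ i x y → frob i (x * y) ≈ frob i x * frob i y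
  frob-* i x y = ^-distrib-* x y (q ℕ.^ i)

  frob-+ : ∀ i x y → frob i (x + y) ≈ frob i x + frob i y
  frob-+ i x y rewrite ℕ.^-*-assoc p e i = +-^p^ p-prime p×1≈0 (e ℕ.* i) x y

  frob-1 : ∀ i → frob i 1# ≈ 1#
  frob-1 i = 1^ (q ℕ.^ i)

  frob-0 : ∀ i → frob i 0# ≈ 0#
  frob-0 i = identityʳ-unique (frob i 0#) (frob i 0#)
    (trans (sym (frob-+ i 0# 0#)) (frob-cong i (+-identityˡ 0#)))

  frob-neg : ∀ i x → frob i (- x) ≈ - frob i x
  frob-neg i x = inverseˡ-unique _ _
    (trans (sym (frob-+ i (- x) x)) (trans (frob-cong i (-‿inverseˡ x)) (frob-0 i)))

  frob-zero : ∀ x → frob 0 x ≈ x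
  frob-zero x = *-identityʳ x

  frob-∘ : ∀ i j x → frob i (frob j x) ≈ frob (j ℕ.+ i) x
  frob-∘ i j x = trans (^-assocʳ x (q ℕ.^ j) (q ℕ.^ i))
    (reflexive (≡.cong (x ^_) (≡.sym (ℕ.^-distribˡ-+-* q j i))))

  frob-1-∘ : ∀ i x → frob 1 (frob i x) ≈ frob (suc i) x
  frob-1-∘ i x = trans (frob-∘ 1 i x) (reflexive (≡.cong (λ k → frob k x) (ℕ.+-comm i 1)))

  -- By additivity a trivial kernel suffices, and K has no nilpotents.
  frob-injective : ∀ i {x y} → frob i x ≈ frob i y → x ≈ y
  frob-injective i {x} {y} xq≈yq = x∙y⁻¹≈ε⇒x≈y x y (^≈0⇒≈0 (q ℕ.^ i) (begin
    frob i (x + - y)         ≈⟨ frob-+ i x (- y) ⟩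
    frob i x + frob i (- y)  ≈⟨ +-cong xq≈yq (frob-neg i y) ⟩
    frob i y + - frob i y    ≈⟨ -‿inverseʳ _ ⟩
    0#                       ∎))

  frob-qth-root : ∀ a → frob 1 (qth-root a) ≈ a
  frob-qth-root a = x∙y⁻¹≈ε⇒x≈y _ a (begin
    b ^ (q ℕ.* 1) + - a                 ≡⟨ ≡.cong (λ n → b ^ n + - a) q*1≡suc ⟩
    b * b ^ pred q + - a                ≈⟨ +-comm _ _ ⟩
    - a + b * b ^ pred q                ≈⟨ +-congˡ (*-congˡ (Monomials.eval-monomial K-ring (pred q) b)) ⟨
    eval (- a ∷ Monomials.monomial K-ring (pred q)) b  ≈⟨ is-root ⟩
    0#                                  ∎)
    where
    b = qth-root a

    -- `frob 1` has exponent q ^ 1, which computes to q * 1, while the polynomial in `qth-root` is -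
    -- a + X · X^(q - 1).
    q*1≡suc : q ℕ.* 1 ≡ suc (pred q)
    q*1≡suc = ≡.trans (ℕ.*-identityʳ q) (≡.sym (ℕ.suc-pred q))

    is-root : eval (- a ∷ Monomials.monomial K-ring (pred q)) b ≈ 0#
    is-root = proj₂ (IsAlgebraicClosure.algebraicallyClosed K-alg (- a ∷ Monomials.monomial K-ring (pred q)) _)

  qth-root-unique : ∀ {a b} → frob 1 b ≈ a → qth-root a ≈ b
  qth-root-unique {a} bq≈a = frob-injective 1 (trans (frob-qth-root a) (sym bq≈a))

  -- By uniqueness of q-th roots each law reduces to the corresponding law for `frob 1`.
  qth-root-homo : IsRingHomomorphism K-raw K-raw qth-root
  qth-root-homo = record
    { isSemiringHomomorphism = record
      { isNearSemiringHomomorphism = record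
        { +-isMonoidHomomorphism = record
          { isMagmaHomomorphism = record
            { isRelHomomorphism = record
              { cong = λ {a} {b} a≈b → qth-root-unique (trans (frob-qth-root b) (sym a≈b)) }
            ; homo = λ a b → qth-root-unique
                (trans (frob-+ 1 _ _) (+-cong (frob-qth-root a) (frob-qth-root b)))
            }
          ; ε-homo = qth-root-unique (frob-0 1)
          }
        ; *-homo = λ a b → qth-root-unique
            (trans (frob-* 1 _ _) (*-cong (frob-qth-root a) (frob-qth-root b)))
        }
      ; 1#-homo = qth-root-unique (frob-1 1)
      }
    ; -‿homo = λ a → qth-root-unique (trans (frob-neg 1 _) (-‿cong (frob-qth-root a)))
    }

  -- Skew polynomials as functions on K.

  -- The factor τ on the right of the tail is moved into the argument, which turns the indexed sum
  -- into a recursion on the list of coefficients.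
  evalᵀ-∷ : ∀ a f x → evalᵀ (a ∷ f) x ≈ a * x + evalᵀ f (frob 1 x)
  evalᵀ-∷ a f x = +-cong (*-congˡ (frob-zero x)) (sum-cong-≋ {length f} λ i → *-congˡ (sym (frob-∘ (toℕ i) 1 x)))
    where open Summation semiring using (sum-cong-≋)

  evalᵀ-congʳ : ∀ f {x y} → x ≈ y → evalᵀ f x ≈ evalᵀ f y
  evalᵀ-congʳ []      x≈y = refl
  evalᵀ-congʳ (a ∷ f) {x} {y} x≈y = begin
    evalᵀ (a ∷ f) x            ≈⟨ evalᵀ-∷ a f x ⟩
    a * x + evalᵀ f (frob 1 x) ≈⟨ +-cong (*-congˡ x≈y) (evalᵀ-congʳ f (frob-cong 1 x≈y)) ⟩
    a * y + evalᵀ f (frob 1 y) ≈⟨ evalᵀ-∷ a f y ⟨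
    evalᵀ (a ∷ f) y            ∎

  evalᵀ-≋[] : ∀ {f} → f ≋ [] → ∀ x → evalᵀ f x ≈ 0#
  evalᵀ-≋[] {[]}    f≈0 x = refl
  evalᵀ-≋[] {a ∷ f} f≈0 x = begin
    evalᵀ (a ∷ f) x             ≈⟨ evalᵀ-∷ a f x ⟩
    a * x + evalᵀ f (frob 1 x)  ≈⟨ +-cong (*-congʳ (f≈0 .at 0)) (evalᵀ-≋[] {f} (pointwise (f≈0 .at ∘ suc)) _) ⟩
    0# * x + 0#                 ≈⟨ trans (+-identityʳ _) (zeroˡ x) ⟩
    0#                          ∎

  evalᵀ-0 : ∀ f → evalᵀ f 0# ≈ 0#
  evalᵀ-0 []      = refl
  evalᵀ-0 (a ∷ f) = begin
    evalᵀ (a ∷ f) 0#              ≈⟨ evalᵀ-∷ a f 0# ⟩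
    a * 0# + evalᵀ f (frob 1 0#)  ≈⟨ +-cong (zeroʳ a) (trans (evalᵀ-congʳ f (frob-0 1)) (evalᵀ-0 f)) ⟩
    0# + 0#                       ≈⟨ +-identityˡ 0# ⟩
    0#                            ∎

  evalᵀ-+ : ∀ f g x → evalᵀ (f +ᴾ g) x ≈ evalᵀ f x + evalᵀ g x
  evalᵀ-+ []      g       x = sym (+-identityˡ _)
  evalᵀ-+ (a ∷ f) []      x = sym (+-identityʳ _)
  evalᵀ-+ (a ∷ f) (b ∷ g) x = begin
    evalᵀ ((a ∷ f) +ᴾ (b ∷ g)) x                         ≈⟨ evalᵀ-∷ (a + b) (f +ᴾ g) x ⟩
    (a + b) * x + evalᵀ (f +ᴾ g) (frob 1 x)              ≈⟨ +-cong (distribʳ x a b) (evalᵀ-+ f g (frob 1 x)) ⟩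
    a * x + b * x + (evalᵀ f (frob 1 x) + evalᵀ g (frob 1 x)) ≈⟨ interchange _ _ _ _ ⟩
    a * x + evalᵀ f (frob 1 x) + (b * x + evalᵀ g (frob 1 x)) ≈⟨ +-cong (evalᵀ-∷ a f x) (evalᵀ-∷ b g x) ⟨
    evalᵀ (a ∷ f) x + evalᵀ (b ∷ g) x                    ∎

  evalᵀ-neg : ∀ f x → evalᵀ (-ᴾ f) x ≈ - evalᵀ f x
  evalᵀ-neg f x = inverseˡ-unique _ _ (trans (sym (evalᵀ-+ (-ᴾ f) f x))
    (evalᵀ-≋[] (CommutativeRing.-‿inverseˡ polynomialRing f) x))

  -- Equal skew polynomials may be lists of different lengths, so the claim is reduced to their
  -- difference, which is zero.
  evalᵀ-congˡ : ∀ {f g} → f ≋ g → ∀ x → evalᵀ f x ≈ evalᵀ g x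
  evalᵀ-congˡ {f} {g} f≈g x = x∙y⁻¹≈ε⇒x≈y _ _ (begin
    evalᵀ f x + - evalᵀ g x     ≈⟨ +-congˡ (evalᵀ-neg g x) ⟨
    evalᵀ f x + evalᵀ (-ᴾ g) x  ≈⟨ evalᵀ-+ f (-ᴾ g) x ⟨
    evalᵀ (f +ᴾ (-ᴾ g)) x       ≈⟨ evalᵀ-≋[] (T.trans (T.+-congʳ f≈g) (T.-‿inverseʳ g)) x ⟩
    0#                          ∎)
    where module T = CommutativeRing polynomialRing

  -- Here σ and τ are scalars, not operators. The result represents the map x ↦ f(σ x) - τ f(x), the
  -- combination by which Artin's argument eliminates a term.
  dilate : Carrier → Carrier → List Carrier → List Carrier
  dilate σ τ []      = []
  dilate σ τ (a ∷ f) = a * (σ - τ) ∷ dilate (frob 1 σ) τ f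

  length-dilate : ∀ σ τ f → length (dilate σ τ f) ≡ length f
  length-dilate σ τ []      = ≡.refl
  length-dilate σ τ (a ∷ f) = ≡.cong suc (length-dilate (frob 1 σ) τ f)

  coeff-dilate : ∀ σ τ f n → coeff (dilate σ τ f) n ≈ coeff f n * (frob n σ - τ)
  coeff-dilate σ τ []      n       = sym (zeroˡ _)
  coeff-dilate σ τ (a ∷ f) zero    = *-congˡ (+-congʳ (sym (frob-zero σ)))
  coeff-dilate σ τ (a ∷ f) (suc n) =
    trans (coeff-dilate (frob 1 σ) τ f n) (*-congˡ (+-congʳ (frob-∘ n 1 σ)))

  evalᵀ-dilate : ∀ σ τ f x → evalᵀ (dilate σ τ f) x ≈ evalᵀ f (σ * x) - τ * evalᵀ f x
  evalᵀ-dilate σ τ [] x = sym (trans (+-congˡ (trans (-‿cong (zeroʳ τ)) -0#≈0#)) (+-identityʳ _))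
  evalᵀ-dilate σ τ (a ∷ f) x = begin
    evalᵀ (dilate σ τ (a ∷ f)) x
      ≈⟨ evalᵀ-∷ (a * (σ - τ)) (dilate (frob 1 σ) τ f) x ⟩
    a * (σ - τ) * x + evalᵀ (dilate (frob 1 σ) τ f) y
      ≈⟨ +-cong head (evalᵀ-dilate (frob 1 σ) τ f y) ⟩
    (a * (σ * x) - τ * (a * x)) + (evalᵀ f (frob 1 σ * y) - τ * evalᵀ f y)
      ≈⟨ interchange _ _ _ _ ⟩
    (a * (σ * x) + evalᵀ f (frob 1 σ * y)) + (- (τ * (a * x)) - τ * evalᵀ f y)
      ≈⟨ +-cong (+-congˡ (evalᵀ-congʳ f (frob-* 1 σ x))) (sym (-‿+-comm _ _)) ⟨
    (a * (σ * x) + evalᵀ f (frob 1 (σ * x))) - (τ * (a * x) + τ * evalᵀ f y)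
      ≈⟨ +-cong (evalᵀ-∷ a f (σ * x)) (-‿cong (trans (*-congˡ (evalᵀ-∷ a f x)) (distribˡ τ _ _))) ⟨
    evalᵀ (a ∷ f) (σ * x) - τ * evalᵀ (a ∷ f) x ∎
    where
    y = frob 1 x

    head : a * (σ - τ) * x ≈ a * (σ * x) - τ * (a * x)
    head = begin
      a * (σ - τ) * x           ≈⟨ *-assoc a _ x ⟩
      a * ((σ - τ) * x)         ≈⟨ *-congˡ ([y-z]x≈yx-zx x σ τ) ⟩
      a * (σ * x - τ * x)       ≈⟨ distribˡ a _ _ ⟩
      a * (σ * x) + a * - (τ * x)  ≈⟨ +-congˡ (-‿distribʳ-* a (τ * x)) ⟨
      a * (σ * x) - a * (τ * x)    ≈⟨ +-congˡ (-‿cong (x∙yz≈y∙xz a τ x)) ⟩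
      a * (σ * x) - τ * (a * x) ∎

  1<q : 1 < q
  1<q = ℕ.^-monoʳ-< p (ℕ.nonTrivial⇒n>1 p ⦃ prime⇒nonTrivial p-prime ⦄) e-pos

  q^-injective : ∀ {i j} → q ℕ.^ i ≡ q ℕ.^ j → i ≡ j
  q^-injective {i} {j} qⁱ≡qʲ with ℕ.<-cmp i j
  ... | tri< i<j _ _ = contradiction qⁱ≡qʲ (ℕ.<⇒≢ (ℕ.^-monoʳ-< q 1<q i<j))
  ... | tri≈ _ i≡j _ = i≡j
  ... | tri> _ _ j<i = contradiction (≡.sym qⁱ≡qʲ) (ℕ.<⇒≢ (ℕ.^-monoʳ-< q 1<q j<i))

  frob-θ-injective : ∀ {i j} → frob i θ ≈ frob j θ → i ≡ j
  frob-θ-injective = q^-injective ∘ θ^-injective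

  -- Artin's independence of characters: the maps x ↦ x^(qⁱ) take different values at θ.
  evalᵀ-independent : ∀ n f m → length f ℕ.≤ n → (∀ x → evalᵀ f (frob m x) ≈ 0#) → f ≋ []
  evalᵀ-independent n       []      m f≤n       f≈0 = pointwise λ _ → refl
  -- The tail is only ever seen at the arguments x^(q^(m+1)), hence the general m; the recursive
  -- call is on a dilation of the tail, which is no sublist, hence the bound n on the length.
  evalᵀ-independent (suc n) (a ∷ f) m (ℕ.s≤s f≤n) af≈0 = T.trans (∷-cong a≈0 f≋[]) 0∷[]≋[]
    where
    module T = CommutativeRing polynomialRing
    τ = frob m θ
    σ = frob 1 τ

    recurse : ∀ x → evalᵀ f (frob 1 (frob m x)) ≈ - (a * frob m x)
    recurse x = inverseʳ-unique _ _ (trans (sym (evalᵀ-∷ a f (frob m x))) (af≈0 x))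

    -- Subtracting τ times the relation at x from the relation at θ x cancels the contribution of a,
    -- because (θ x)^(q^m) = τ x^(q^m).
    dilated : dilate σ τ f ≋ []
    dilated = evalᵀ-independent n (dilate σ τ f) (suc m)
      (ℕ.≤-trans (ℕ.≤-reflexive (length-dilate σ τ f)) f≤n) λ x → let y = frob m x in begin
        evalᵀ (dilate σ τ f) (frob (suc m) x)
          ≈⟨ evalᵀ-congʳ (dilate σ τ f) (frob-1-∘ m x) ⟨
        evalᵀ (dilate σ τ f) (frob 1 y)
          ≈⟨ evalᵀ-dilate σ τ f (frob 1 y) ⟩
        evalᵀ f (σ * frob 1 y) - τ * evalᵀ f (frob 1 y)
          ≈⟨ +-congʳ (evalᵀ-congʳ f (trans (frob-cong 1 (frob-* m θ x)) (frob-* 1 τ y))) ⟨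
        evalᵀ f (frob 1 (frob m (θ * x))) - τ * evalᵀ f (frob 1 y)
          ≈⟨ +-cong (recurse (θ * x)) (-‿cong (*-congˡ (recurse x))) ⟩
        - (a * frob m (θ * x)) - τ * - (a * y)
          ≈⟨ +-congʳ (-‿cong (trans (*-congˡ (frob-* m θ x)) (x∙yz≈y∙xz a τ y))) ⟩
        - (τ * (a * y)) - τ * - (a * y)
          ≈⟨ +-congʳ (-‿distribʳ-* τ (a * y)) ⟩
        τ * - (a * y) - τ * - (a * y)
          ≈⟨ -‿inverseʳ _ ⟩
        0# ∎

    f≋[] : f ≋ []
    f≋[] .at i = *-cancel-zero distinct (trans (sym (coeff-dilate σ τ f i)) (dilated .at i))
      where
      -- The two scalars are θ raised to q^(m+1+i) and to q^m.
      distinct : ¬ (frob i σ - τ ≈ 0#)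
      distinct eq = ℕ.m+1+n≢m m (frob-θ-injective (begin
        frob (m ℕ.+ suc i) θ  ≈⟨ frob-∘ (suc i) m θ ⟨
        frob (suc i) τ        ≈⟨ frob-∘ i 1 τ ⟨
        frob i σ              ≈⟨ x∙y⁻¹≈ε⇒x≈y _ _ eq ⟩
        frob m θ              ∎))

    a≈0 : a ≈ 0#
    a≈0 = begin
      a                                        ≈⟨ *-identityʳ a ⟨
      a * 1#                                   ≈⟨ *-congˡ (frob-1 m) ⟨
      a * frob m 1#                            ≈⟨ +-identityʳ _ ⟨
      a * frob m 1# + 0#                       ≈⟨ +-congˡ (evalᵀ-≋[] {f} f≋[] _) ⟨
      a * frob m 1# + evalᵀ f (frob 1 (frob m 1#)) ≈⟨ evalᵀ-∷ a f (frob m 1#) ⟨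
      evalᵀ (a ∷ f) (frob m 1#)                ≈⟨ af≈0 1# ⟩
      0#                                       ∎

  evalᵀ-injective : ∀ f g → (∀ x → evalᵀ f x ≈ evalᵀ g x) → f ≋ g
  evalᵀ-injective f g f≈g = GP.x∙y⁻¹≈ε⇒x≈y f g
    (evalᵀ-independent _ (f +ᴾ (-ᴾ g)) 0 ℕ.≤-refl λ x → begin
      evalᵀ (f +ᴾ (-ᴾ g)) (frob 0 x)  ≈⟨ evalᵀ-congʳ (f +ᴾ (-ᴾ g)) (frob-zero x) ⟩
      evalᵀ (f +ᴾ (-ᴾ g)) x           ≈⟨ evalᵀ-+ f (-ᴾ g) x ⟩
      evalᵀ f x + evalᵀ (-ᴾ g) x      ≈⟨ +-cong (f≈g x) (evalᵀ-neg g x) ⟩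
      evalᵀ g x + - evalᵀ g x         ≈⟨ -‿inverseʳ _ ⟩
      0#                              ∎)
    where module GP = AbelianGroupProperties +ᴾ-abelianGroup

-- Ring identities for division and for the formula of σ.

module RingIdentities {c ℓ} (R : CommutativeRing c ℓ) where
  open CommutativeRing R
  open RingProperties ring using (-‿distribˡ-*)
  open CommutativeSemigroupProperties *-commutativeSemigroup using (x∙yz≈y∙xz; x∙yz≈zx∙y)
  open SetoidReasoning setoid

  -- The inductive step of synthetic division by x - y: a tail with remainder e and quotient f gives
  -- remainder b + y e and quotient e + x f.
  horner : ∀ b e x y f → b + x * (e + (x - y) * f) ≈ b + y * e + (x - y) * (e + x * f)
  horner b e x y f = begin
    b + x * (e + (x - y) * f)                         ≈⟨ +-congˡ (distribˡ x e _) ⟩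
    b + (x * e + x * ((x - y) * f))                   ≈⟨ +-congˡ (+-cong (*-congʳ split) (x∙yz≈y∙xz x (x - y) f)) ⟩
    b + ((y + (x - y)) * e + (x - y) * (x * f))       ≈⟨ +-congˡ (+-congʳ (distribʳ e y (x - y))) ⟩
    b + (y * e + (x - y) * e + (x - y) * (x * f))     ≈⟨ +-congˡ (+-assoc _ _ _) ⟩
    b + (y * e + ((x - y) * e + (x - y) * (x * f)))   ≈⟨ +-assoc _ _ _ ⟨
    b + y * e + ((x - y) * e + (x - y) * (x * f))     ≈⟨ +-congˡ (distribˡ (x - y) e (x * f)) ⟨
    b + y * e + (x - y) * (e + x * f)                 ∎
    where
    split : x ≈ y + (x - y)
    split = sym (begin
      y + (x - y)    ≈⟨ +-comm y (x - y) ⟩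
      x - y + y      ≈⟨ +-assoc x (- y) y ⟩
      x + (- y + y)  ≈⟨ +-congˡ (-‿inverseˡ y) ⟩
      x + 0#         ≈⟨ +-identityʳ x ⟩
      x              ∎)

  -- For `low-split`: a + t f is the division of g by t - θ, with `t` in the role of t - θ, and p is
  -- the power already present.
  split-off : ∀ c p a t f z → (c * (p * (a + t * f))) * z ≈ (a * c) * (p * z) + (c * (t * p * f)) * z
  split-off c p a t f z = begin
    (c * (p * (a + t * f))) * z             ≈⟨ *-congʳ (*-congˡ (distribˡ p a (t * f))) ⟩
    (c * (p * a + p * (t * f))) * z         ≈⟨ *-congʳ (distribˡ c _ _) ⟩
    (c * (p * a) + c * (p * (t * f))) * z   ≈⟨ distribʳ z _ _ ⟩
    c * (p * a) * z + c * (p * (t * f)) * z ≈⟨ +-cong leading (*-congʳ (*-congˡ trailing)) ⟩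
    (a * c) * (p * z) + (c * (t * p * f)) * z ∎
    where
    leading : c * (p * a) * z ≈ (a * c) * (p * z)
    leading = trans (*-congʳ (x∙yz≈zx∙y c p a)) (*-assoc (a * c) p z)

    trailing : p * (t * f) ≈ t * p * f
    trailing = trans (x∙yz≈y∙xz p t f) (sym (*-assoc t p f))

  -- For `high-suc`: the bracket is the formula for σ m_ℓ with x and y coordinates of m_(ℓ-1) and
  -- m_ℓ, and the last summand removes the m_(ℓ-1) part.
  cancel-middle : ∀ f h p x p′ y → (f * p′) * y ≈ f * ((h * p) * x + p′ * y) + (- (f * h) * p) * x
  cancel-middle f h p x p′ y = sym (begin
    f * (h * p * x + p′ * y) + - (f * h) * p * x
      ≈⟨ +-cong (trans (distribˡ f _ _) (+-comm _ _)) negate ⟩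
    f * (p′ * y) + f * (h * p * x) - f * (h * p * x)
      ≈⟨ +-assoc _ _ _ ⟩
    f * (p′ * y) + (f * (h * p * x) - f * (h * p * x))
      ≈⟨ +-congˡ (-‿inverseʳ _) ⟩
    f * (p′ * y) + 0#
      ≈⟨ +-identityʳ _ ⟩
    f * (p′ * y)
      ≈⟨ *-assoc f p′ y ⟨
    f * p′ * y ∎)
    where
    negate : - (f * h) * p * x ≈ - (f * (h * p * x))
    negate = begin
      - (f * h) * p * x      ≈⟨ *-congʳ (-‿distribˡ-* (f * h) p) ⟨
      - (f * h * p) * x      ≈⟨ -‿distribˡ-* (f * h * p) x ⟨
      - (f * h * p * x)      ≈⟨ -‿cong (trans (*-congʳ (*-assoc f h p)) (*-assoc f (h * p) x)) ⟩
      - (f * (h * p * x))    ∎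

-- Indexing of the basis ν.

unblock : ∀ {r} (w : Vector ℕ r) ℓ (j : Fin (w ℓ)) → ∃[ i ] block w i ≡ (ℓ , j)
unblock {suc r} w zero j = j ↑ˡ sumℕ (tail w) , ≡.cong
  [ zero ,_ , Product.map suc id ∘ block (tail w) ]′ (Fin.splitAt-↑ˡ (w zero) j (sumℕ (tail w)))
unblock {suc r} w (suc ℓ) j with unblock (tail w) ℓ j
... | i , eq = w zero ↑ʳ i , ≡.trans
  (≡.cong [ zero ,_ , Product.map suc id ∘ block (tail w) ]′ (Fin.splitAt-↑ʳ (w zero) (sumℕ (tail w)) i))
  (≡.cong (Product.map suc id) eq)

weight-positive : ∀ {r} (𝔰 : Vector ℕ r) → (∀ ℓ → 1 ≤ 𝔰 ℓ) → ∀ ℓ → 1 ≤ weight 𝔰 ℓ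
weight-positive {suc r} 𝔰 𝔰≥1 zero    = ℕ.≤-trans (𝔰≥1 zero) (ℕ.m≤m+n _ _)
weight-positive {suc r} 𝔰 𝔰≥1 (suc ℓ) = weight-positive (tail 𝔰) (𝔰≥1 ∘ suc) ℓ

-- Identifies the exponent s_r of the special point with w_r, the exponent occurring in `high`.
weight-last : ∀ {n} (𝔰 : Vector ℕ (suc n)) → weight 𝔰 (fromℕ n) ≡ 𝔰 (fromℕ n)
weight-last {zero}  𝔰 = ℕ.+-identityʳ _
weight-last {suc n} 𝔰 = weight-last (tail 𝔰)

-- Polymorphic, since it serves both as the K[σ]-coordinates of a multiple of ν_i and as a column
-- with coefficients in A.
single : ∀ {a} {A : Set a} {n} → Fin n → A → Fin n → List A
single i a j with i Fin.≟ j
... | yes _ = [ a ]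
... | no  _ = []

single-≡ : ∀ {a} {A : Set a} {n} (i : Fin n) (x : A) → single i x i ≡ [ x ]
single-≡ i x with i Fin.≟ i
... | yes _   = ≡.refl
... | no  i≢i = contradiction ≡.refl i≢i

single-≢ : ∀ {a} {A : Set a} {n} {i j : Fin n} (x : A) → i ≢ j → single i x j ≡ []
single-≢ {i = i} {j} x i≢j with i Fin.≟ j
... | yes i≡j = contradiction i≡j i≢j
... | no  _   = ≡.refl

-- The module M′, the action of σ, and expansions in the basis ν.

module Expansion {c ℓ₁ ℓ₂} (B : BaseData c ℓ₁ ℓ₂)
         (H : ℕ → RawRing.Carrier (BaseData.A[t] B))
         {n : ℕ} (𝔰 : Vector ℕ (suc n)) where
  open BaseData B hiding (p; e; k)
  open Construction B H 𝔰
  open ScalarProperties B hiding (module ιA)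
  open PolynomialRing K-ring
  open PolynomialMap K-raw K-ring qth-root-homo using () renaming
    (map-cong to twist-cong; map-+ to twist-+; map-* to twist-*; map-neg to twist-neg)

  open K-poly using (const; _+ᴾ_)

  module T-ring = RingProperties (CommutativeRing.ring polynomialRing)
  module R = CommutativeRing K-ring
  module T = CommutativeRing polynomialRing
  open T using (_+_; _*_)
  module ∑ = Summation T.semiring
  module R-additive = CommutativeSemigroupProperties R.+-commutativeSemigroup
  module T-additive = CommutativeSemigroupProperties T.+-commutativeSemigroup
  module T-multiplicative = CommutativeSemigroupProperties T.*-commutativeSemigroup
  open SumProperties polynomialRing
  open RingIdentities polynomialRing

  δ-∷ : ∀ a u → δ (a ∷ u) R.≈ a R.+ frob 1 (δ u)
  δ-∷ a u = R.+-cong (frob-zero a) (frobs u id)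
    where
    -- The shift s lets the recursion on u absorb the successor that each further coefficient adds
    -- to the exponent.
    frobs : ∀ u (s : ℕ → ℕ) → K.sum (λ i → frob (suc (s (toℕ i))) (lookup u i)) R.≈
                              frob 1 (K.sum λ i → frob (s (toℕ i)) (lookup u i))
    frobs []      s = R.sym (frob-0 1)
    frobs (b ∷ u) s = R.trans (R.+-cong (R.sym (frob-1-∘ (s 0) b)) (frobs u (s ∘ suc))) (R.sym (frob-+ 1 _ _))

  δ-+ : ∀ u v → δ (u +ᴾ v) R.≈ δ u R.+ δ v
  δ-+ []      v       = R.sym (R.+-identityˡ _)
  δ-+ (a ∷ u) []      = R.sym (R.+-identityʳ _)
  δ-+ (a ∷ u) (b ∷ v) = begin
    δ (a R.+ b ∷ (u +ᴾ v))                         ≈⟨ δ-∷ (a R.+ b) (u +ᴾ v) ⟩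
    a R.+ b R.+ frob 1 (δ (u +ᴾ v))                ≈⟨ R.+-congˡ (R.trans (frob-cong 1 (δ-+ u v)) (frob-+ 1 _ _)) ⟩
    a R.+ b R.+ (frob 1 (δ u) R.+ frob 1 (δ v))    ≈⟨ R-additive.interchange _ _ _ _ ⟩
    a R.+ frob 1 (δ u) R.+ (b R.+ frob 1 (δ v))    ≈⟨ R.sym (R.+-cong (δ-∷ a u) (δ-∷ b v)) ⟩
    δ (a ∷ u) R.+ δ (b ∷ v)                        ∎
    where
    open SetoidReasoning R.setoid

  -- Multiplication by σ turns c σ^i into c^(1/q) σ^(i+1), and raising c^(1/q) to q^(i+1) gives
  -- c^(q^i) again.
  δ-σ : ∀ u → δ (R.0# ∷ u ⁽⁻¹⁾) R.≈ δ u
  δ-σ u = R.trans (δ-∷ R.0# (u ⁽⁻¹⁾)) (R.trans (R.+-identityˡ _) (untwist u))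
    where
    untwist : ∀ u → frob 1 (δ (u ⁽⁻¹⁾)) R.≈ δ u
    untwist []      = frob-0 1
    untwist (a ∷ u) = R.trans (frob-cong 1 (δ-∷ (qth-root a) (u ⁽⁻¹⁾)))
      (R.trans (frob-+ 1 _ _) (R.trans (R.+-cong (frob-qth-root a) (frob-cong 1 (untwist u))) (R.sym (δ-∷ a u))))

  open SetoidReasoning T.setoid

  infix 4 _≋ᴹ_
  _≋ᴹ_ : M′ → M′ → Set ℓ₁
  x ≋ᴹ y = ∀ ℓ → x ℓ ≋ y ℓ

  const-cong : ∀ {a b} → a R.≈ b → const a ≋ const b
  const-cong a≈b = ∷-cong a≈b T.refl

  const-homo-* : ∀ a b → const (a R.* b) ≋ const a * const b
  const-homo-* a b = T.sym (const-* a (const b))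

  ι : List A.Carrier → K[t].Carrier
  ι = List.map ιA

  module ιA = ScalarProperties.ιA B
  open PolynomialMap A K-ring ιA.isRingHomomorphism using () renaming
    (map-+ to ι-+; map-* to ι-*; map-neg to ι-neg)

  m-≡ : ∀ ℓ → m ℓ ℓ ≡ K[t].1#
  m-≡ ℓ with ℓ Fin.≟ ℓ
  ... | yes _   = ≡.refl
  ... | no  ℓ≢ℓ = contradiction ≡.refl ℓ≢ℓ

  m-≢ : ∀ {i j} → i ≢ j → m i j ≡ K[t].0#
  m-≢ {i} {j} i≢j with i Fin.≟ j
  ... | yes i≡j = contradiction i≡j i≢j
  ... | no  _   = ≡.refl

  σ-cong : ∀ {x y} → x ≋ᴹ y → σ x ≋ᴹ σ y
  σ-cong {x} {y} x≋y j = sum-*-congʳ (λ i → x i ⁽⁻¹⁾) (λ i → y i ⁽⁻¹⁾) (λ i → σm i j)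
    λ i → twist-cong {x i} {y i} (x≋y i .at)

  σ-+ : ∀ x y → σ (x +ᴹ y) ≋ᴹ σ x +ᴹ σ y
  σ-+ x y j = T.trans
    (sum-*-congʳ (λ i → (x i + y i) ⁽⁻¹⁾) (λ i → x i ⁽⁻¹⁾ + y i ⁽⁻¹⁾) (λ i → σm i j)
      λ i → twist-+ (x i) (y i))
    (sum-*-+ (λ i → x i ⁽⁻¹⁾) (λ i → y i ⁽⁻¹⁾) (λ i → σm i j))

  σ-• : ∀ f x → σ (f • x) ≋ᴹ f ⁽⁻¹⁾ • σ x
  σ-• f x j = T.trans
    (sum-*-congʳ (λ i → (f * x i) ⁽⁻¹⁾) (λ i → f ⁽⁻¹⁾ * x i ⁽⁻¹⁾) (λ i → σm i j)
      λ i → twist-* f (x i))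
    (sum-*-assoc (f ⁽⁻¹⁾) (λ i → x i ⁽⁻¹⁾) (λ i → σm i j))

  σ-sum : ∀ {l} (xs : Vector M′ l) → σ (sumᴹ xs) ≋ᴹ sumᴹ (σ ∘ xs)
  σ-sum {zero}  xs j = sum-zero {suc n} _ λ i → T.refl
  σ-sum {suc l} xs j = T.trans (σ-+ (xs zero) (sumᴹ (xs ∘ suc)) j) (T.+-congˡ (σ-sum (xs ∘ suc) j))

  σ-m : ∀ f ℓ → σ (f • m ℓ) ≋ᴹ f ⁽⁻¹⁾ • σm ℓ
  σ-m f ℓ j = T.trans (σ-• f (m ℓ) j) (T.*-congˡ {f ⁽⁻¹⁾} (begin
    σ (m ℓ) j                ≈⟨ sum-single ℓ (λ i → m ℓ i ⁽⁻¹⁾ * σm i j) off-diagonal ⟩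
    m ℓ ℓ ⁽⁻¹⁾ * σm ℓ j      ≡⟨ ≡.cong (λ f → f ⁽⁻¹⁾ * σm ℓ j) (m-≡ ℓ) ⟩
    T.1# ⁽⁻¹⁾ * σm ℓ j       ≈⟨ T.*-congʳ {σm ℓ j} (const-cong (qth-root-unique (frob-1 1))) ⟩
    T.1# * σm ℓ j            ≈⟨ T.*-identityˡ (σm ℓ j) ⟩
    σm ℓ j                   ∎))
    where
    off-diagonal : ∀ i → ℓ ≢ i → m ℓ i ⁽⁻¹⁾ * σm i j ≋ T.0#
    off-diagonal i ℓ≢i rewrite m-≢ ℓ≢i = T.refl

  σ^-σ : ∀ i x → σ^ i (σ x) ≡ σ (σ^ i x)
  σ^-σ zero    x = ≡.refl
  σ^-σ (suc i) x = ≡.cong σ (σ^-σ i x)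

  •σ-∷ : ∀ a u x → (a ∷ u) •σ x ≋ᴹ const a • x +ᴹ u •σ σ x
  •σ-∷ a u x ℓ = T.+-congˡ {const a * x ℓ}
    (sum-*-congˡ (λ i → σ (σ^ (toℕ i) x) ℓ) (λ i → σ^ (toℕ i) (σ x) ℓ) (const ∘ lookup u)
      λ i → T.reflexive (≡.cong (λ y → y ℓ) (≡.sym (σ^-σ (toℕ i) x))))

  •σ-+ : ∀ u v x → (u +ᴾ v) •σ x ≋ᴹ u •σ x +ᴹ v •σ x
  •σ-+ []      v       x ℓ = T.refl
  •σ-+ (a ∷ u) []      x ℓ = T.sym (T.+-identityʳ _)
  •σ-+ (a ∷ u) (b ∷ v) x ℓ = begin
    ((a R.+ b ∷ (u +ᴾ v)) •σ x) ℓ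
      ≈⟨ •σ-∷ (a R.+ b) (u +ᴾ v) x ℓ ⟩
    (const a + const b) * x ℓ + ((u +ᴾ v) •σ σ x) ℓ
      ≈⟨ T.+-cong (T.distribʳ (x ℓ) (const a) (const b)) (•σ-+ u v (σ x) ℓ) ⟩
    const a * x ℓ + const b * x ℓ + ((u •σ σ x) ℓ + (v •σ σ x) ℓ)
      ≈⟨ T-additive.interchange (const a * x ℓ) (const b * x ℓ) ((u •σ σ x) ℓ) ((v •σ σ x) ℓ) ⟩
    const a * x ℓ + (u •σ σ x) ℓ + (const b * x ℓ + (v •σ σ x) ℓ)
      ≈⟨ T.+-cong (•σ-∷ a u x ℓ) (•σ-∷ b v x ℓ) ⟨
    ((a ∷ u) •σ x) ℓ + ((b ∷ v) •σ x) ℓ ∎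

  -- σ (c σⁱ) = c^(1/q) σⁱ⁺¹.
  σ-•σ : ∀ u x → σ (u •σ x) ≋ᴹ (R.0# ∷ u ⁽⁻¹⁾) •σ x
  σ-•σ u x ℓ = begin
    σ (u •σ x) ℓ                               ≈⟨ shift u x ℓ ⟩
    (u ⁽⁻¹⁾ •σ σ x) ℓ                          ≈⟨ T.+-identityˡ _ ⟨
    T.0# + (u ⁽⁻¹⁾ •σ σ x) ℓ                   ≈⟨ T.+-congʳ (T.trans (T.*-congʳ 0∷[]≋[]) (T.zeroˡ (x ℓ))) ⟨
    const R.0# * x ℓ + (u ⁽⁻¹⁾ •σ σ x) ℓ       ≈⟨ •σ-∷ R.0# (u ⁽⁻¹⁾) x ℓ ⟨
    ((R.0# ∷ u ⁽⁻¹⁾) •σ x) ℓ                   ∎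
    where
    shift : ∀ u x → σ (u •σ x) ≋ᴹ u ⁽⁻¹⁾ •σ σ x
    shift []      x ℓ = sum-zero {suc n} _ λ i → T.refl
    shift (a ∷ u) x ℓ = begin
      σ ((a ∷ u) •σ x) ℓ                              ≈⟨ σ-cong (•σ-∷ a u x) ℓ ⟩
      σ (const a • x +ᴹ u •σ σ x) ℓ                   ≈⟨ σ-+ (const a • x) (u •σ σ x) ℓ ⟩
      σ (const a • x) ℓ + σ (u •σ σ x) ℓ              ≈⟨ T.+-cong (σ-• (const a) x ℓ) (shift u (σ x) ℓ) ⟩
      const (qth-root a) * σ x ℓ + (u ⁽⁻¹⁾ •σ σ (σ x)) ℓ ≈⟨ •σ-∷ (qth-root a) (u ⁽⁻¹⁾) (σ x) ℓ ⟨
      ((a ∷ u) ⁽⁻¹⁾ •σ σ x) ℓ                         ∎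

  -- x ↝ v is Δ x = v, expressed without Δ.
  infix 4 _↝_
  record _↝_ (x : M′) (v : Col) : Set (c ⊔ ℓ₁) where
    field
      coords : Vector K[σ] d
      expand : x ≋ᴹ sumᴹ (λ i → coords i •σ ν i)
      value  : (δ ∘ coords) ≈ᶜ v
  open _↝_

  ↝-respˡ : ∀ {x y v} → x ≋ᴹ y → x ↝ v → y ↝ v
  ↝-respˡ x≋y x↝v = record
    { coords = x↝v .coords ; expand = λ ℓ → T.trans (T.sym (x≋y ℓ)) (x↝v .expand ℓ) ; value = x↝v .value }

  ↝-respʳ : ∀ {x v v′} → v ≈ᶜ v′ → x ↝ v → x ↝ v′
  ↝-respʳ v≈v′ x↝v = record
    { coords = x↝v .coords ; expand = x↝v .expand ; value = λ i → R.trans (x↝v .value i) (v≈v′ i) }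

  ↝-0 : (λ _ → T.0#) ↝ (λ _ → R.0#)
  ↝-0 = record
    { coords = λ _ → [] ; expand = λ ℓ → T.sym (sum-zero {d} _ λ i → T.refl) ; value = λ i → R.refl }

  ↝-+ : ∀ {x y v v′} → x ↝ v → y ↝ v′ → x +ᴹ y ↝ (λ i → v i R.+ v′ i)
  ↝-+ {x} {y} x↝v y↝v′ = record
    { coords = λ i → u i +ᴾ u′ i
    ; expand = λ ℓ → begin
        x ℓ + y ℓ
          ≈⟨ T.+-cong (x↝v .expand ℓ) (y↝v′ .expand ℓ) ⟩
        sumᴹ (λ i → u i •σ ν i) ℓ + sumᴹ (λ i → u′ i •σ ν i) ℓ
          ≈⟨ ∑.∑-distrib-+ {d} _ _ ⟨
        sumᴹ (λ i → u i •σ ν i +ᴹ u′ i •σ ν i) ℓ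
          ≈⟨ ∑.sum-cong-≋ {d} (λ i → •σ-+ (u i) (u′ i) (ν i) ℓ) ⟨
        sumᴹ (λ i → (u i +ᴾ u′ i) •σ ν i) ℓ ∎
    ; value = λ i → R.trans (δ-+ (u i) (u′ i)) (R.+-cong (x↝v .value i) (y↝v′ .value i))
    }
    where
    u  = x↝v .coords
    u′ = y↝v′ .coords

  -- σ changes the coordinates only by left multiplication in K[σ], which δ does not see.
  ↝-σ : ∀ {x v} → x ↝ v → σ x ↝ v
  ↝-σ {x} x↝v = record
    { coords = λ i → R.0# ∷ u i ⁽⁻¹⁾
    ; expand = λ ℓ → begin
        σ x ℓ                                        ≈⟨ σ-cong (x↝v .expand) ℓ ⟩
        σ (sumᴹ (λ i → u i •σ ν i)) ℓ                ≈⟨ σ-sum (λ i → u i •σ ν i) ℓ ⟩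
        sumᴹ (λ i → σ (u i •σ ν i)) ℓ                ≈⟨ ∑.sum-cong-≋ {d} (λ i → σ-•σ (u i) (ν i) ℓ) ⟩
        sumᴹ (λ i → (R.0# ∷ u i ⁽⁻¹⁾) •σ ν i) ℓ      ∎
    ; value = λ i → R.trans (δ-σ (u i)) (x↝v .value i)
    }
    where u = x↝v .coords

  ↝-ν : ∀ a i → const a • ν i ↝ δ ∘ single i a
  ↝-ν a i = record
    { coords = single i a
    ; expand = λ ℓ → T.sym (begin
        sumᴹ (λ j → single i a j •σ ν j) ℓ
          ≈⟨ sum-single i _ (λ j i≢j → T.reflexive (≡.cong (λ u → (u •σ ν j) ℓ) (single-≢ a i≢j))) ⟩
        (single i a i •σ ν i) ℓ
          ≡⟨ ≡.cong (λ u → (u •σ ν i) ℓ) (single-≡ i a) ⟩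
        const a * ν i ℓ + T.0#
          ≈⟨ T.+-identityʳ _ ⟩
        const a * ν i ℓ ∎)
    ; value = λ j → R.refl
    }

  -- Families whose image under Δ is a skew polynomial over A.

  -- Families in c, rather than single elements, because a column of ρ_t is recovered from a map c ↦
  -- Δ(t c ν_i). Each entry of `column` is a coefficient list in A[τ], to be evaluated at c.
  record Integral (F : K.Carrier → M′) : Set (c ⊔ ℓ₁) where
    field
      column   : Fin d → List A.Carrier
      expands  : ∀ c → F c ↝ (λ i → evalᵀ (List.map ιA (column i)) c)
  open Integral

  Integral-resp : ∀ {F G} → (∀ c → F c ≋ᴹ G c) → Integral F → Integral G
  Integral-resp F≋G F-int = record
    { column = F-int .column ; expands = λ c → ↝-respˡ (F≋G c) (F-int .expands c) }

  Integral-0 : Integral (λ _ _ → T.0#)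
  Integral-0 = record { column = λ _ → [] ; expands = λ _ → ↝-0 }

  Integral-+ : ∀ {F G} → Integral F → Integral G → Integral (λ c → F c +ᴹ G c)
  Integral-+ F-int G-int = record
    { column  = λ i → P i A[t].+ Q i
    ; expands = λ c → ↝-respʳ
        (λ i → R.sym (R.trans (evalᵀ-congˡ (ι-+ (P i) (Q i)) c) (evalᵀ-+ (ι (P i)) (ι (Q i)) c)))
        (↝-+ (F-int .expands c) (G-int .expands c))
    }
    where
    P = F-int .column
    Q = G-int .column

  Integral-σ : ∀ {F} → Integral F → Integral (σ ∘ F)
  Integral-σ F-int = record { column = F-int .column ; expands = ↝-σ ∘ F-int .expands }

  -- Substituting c^q for c is multiplication by τ on the right, which shifts the coefficient list
  -- by one.
  Integral-frob : ∀ {F} → Integral F → Integral (F ∘ frob 1)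
  Integral-frob F-int = record
    { column  = λ i → A.0# ∷ Q i
    ; expands = λ c → ↝-respʳ
        (λ i → R.sym (R.trans (evalᵀ-∷ (ιA A.0#) (ι (Q i)) c)
          (R.trans (R.+-congʳ (R.trans (R.*-congʳ ιA.0#-homo) (R.zeroˡ c))) (R.+-identityˡ _))))
        (F-int .expands (frob 1 c))
    }
    where Q = F-int .column

  Integral-ν : ∀ a i → Integral (λ c → const (ιA a R.* c) • ν i)
  Integral-ν a i = record { column = single i a ; expands = λ c → ↝-respʳ (value-single c) (↝-ν (ιA a R.* c) i) }
    where
    value-single : ∀ c → (δ ∘ single i (ιA a R.* c)) ≈ᶜ (λ j → evalᵀ (ι (single i a j)) c)
    value-single c j with i Fin.≟ j
    ... | yes _ = R.+-congʳ (R.trans (frob-zero _) (R.*-congˡ (R.sym (frob-zero c))))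
    ... | no  _ = R.refl

  ν-at : ∀ ℓ j → j < w ℓ → ∃[ i ] ν i ≡ (t-θ K[t].^ j) • m ℓ
  -- Within a block the exponents descend from w_ℓ - 1 to 0, so exponent j sits at the opposite
  -- position.
  ν-at ℓ j j<w with unblock w ℓ (Fin.opposite (fromℕ< j<w))
  ... | i , eq = i , ≡.trans
    (≡.cong (λ b → (t-θ K[t].^ (w (proj₁ b) ∸ suc (toℕ (proj₂ b)))) • m (proj₁ b)) eq)
    (≡.cong (λ a → (t-θ K[t].^ a) • m ℓ) exponent)
    where
    exponent : w ℓ ∸ suc (toℕ (Fin.opposite (fromℕ< j<w))) ≡ j
    exponent = ≡.trans (≡.sym (Fin.opposite-prop (Fin.opposite (fromℕ< j<w))))
      (≡.trans (≡.cong toℕ (Fin.opposite-involutive (fromℕ< j<w))) (Fin.toℕ-fromℕ< j<w))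

  private
    module 𝔽[θ] = Polynomials (DiscreteField.rawRing 𝔽)
    module A-poly = Polynomials A

  -- Division by t - θ over A, and the twist h ↦ h^(1).

  -- Horner's intermediate results: `values g` lists the values at θ of all nonempty suffixes of g.
  -- As t - θ is monic, all of them lie in A.
  values quotient : List A.Carrier → List A.Carrier
  values []      = []
  values (a ∷ g) = A-poly.eval (a ∷ g) 𝔽[θ].X ∷ values g

  -- Synthetic division of g by t - θ, with remainder g(θ).
  quotient []      = []
  quotient (a ∷ g) = values g

  -- The length of the list stands in for the degree; this drop is what lets the recursion
  -- terminate.
  length-quotient : ∀ g → length (quotient g) ≡ pred (length g)
  length-quotient []      = ≡.refl
  length-quotient (a ∷ g) = length-values g
    where
    length-values : ∀ g → length (values g) ≡ length g
    length-values []      = ≡.refl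
    length-values (a ∷ g) = ≡.cong suc (length-values g)

  remainder : List A.Carrier → A.Carrier
  remainder g = A-poly.eval g 𝔽[θ].X

  const-0 : const (ιA A.0#) ≋ T.0#
  const-0 = T.trans (const-cong ιA.0#-homo) 0∷[]≋[]

  ι-values : ∀ g → ι (values g) ≋ const (ιA (remainder g)) + K-poly.X * ι (quotient g)
  ι-values []      = T.sym (T.trans (T.+-cong const-0 (T.zeroʳ K-poly.X)) (T.+-identityˡ T.0#))
  ι-values (a ∷ g) = T.sym (begin
    const r + K-poly.X * ι (values g)   ≈⟨ T.+-congˡ {const r} (Monomials.X*-shift K-ring (ι (values g))) ⟩
    const r + (R.0# ∷ ι (values g))     ≈⟨ ∷-cong (R.+-identityʳ r) T.refl ⟩
    r ∷ ι (values g)                    ∎)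
    where r = ιA (remainder (a ∷ g))

  division : ∀ g → ι g ≋ const (ιA (remainder g)) + t-θ * ι (quotient g)
  division []      = T.sym (T.trans (T.+-cong const-0 (T.zeroʳ t-θ)) (T.+-identityˡ T.0#))
  division (a ∷ g) = begin
    ιA a ∷ ι g
      ≈⟨ ∷-cong (R.+-identityʳ (ιA a)) (T.refl {ι g}) ⟨
    const (ιA a) + (R.0# ∷ ι g)
      ≈⟨ T.+-congˡ {const (ιA a)} (Monomials.X*-shift K-ring (ι g)) ⟨
    const (ιA a) + K-poly.X * ι g
      ≈⟨ T.+-congˡ {const (ιA a)} (T.*-congˡ {K-poly.X} (division g)) ⟩
    const (ιA a) + K-poly.X * (const r + t-θ * ι (quotient g))
      ≈⟨ horner (const (ιA a)) (const r) K-poly.X (const θ) (ι (quotient g)) ⟩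
    const (ιA a) + const θ * const r + t-θ * (const r + K-poly.X * ι (quotient g))
      ≈⟨ T.+-cong (const-cong evaluate) (T.*-congˡ {t-θ} (ι-values g)) ⟨
    const (ιA (remainder (a ∷ g))) + t-θ * ι (values g) ∎
    where
    r = ιA (remainder g)
    evaluate : ιA (remainder (a ∷ g)) R.≈ ιA a R.+ (θ R.* r R.+ R.0#)
    evaluate = R.trans (ιA.+-homo _ _) (R.+-congˡ (R.trans (ιA.*-homo _ _) (R.sym (R.+-identityʳ _))))

  -- The twist h^(1). Unlike its inverse it stays over A, and it keeps the length.
  frobᴬ : List A.Carrier → List A.Carrier
  frobᴬ = List.map λ a → Ops._^_ A a (q ℕ.^ 1)

  ι-frobᴬ : ∀ g → ι (frobᴬ g) ⁽⁻¹⁾ ≋ ι g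
  ι-frobᴬ []      = T.refl
  ι-frobᴬ (a ∷ g) = ∷-cong (qth-root-unique (R.sym (ιA-^ a (q ℕ.^ 1)))) (ι-frobᴬ g)

  low : Fin (suc n) → ℕ → List A.Carrier → K.Carrier → M′
  low ℓ j g c = (const c * (t-θ K[t].^ j * ι g)) • m ℓ

  -- Elements to which the formula for σ m_ℓ applies.
  high : Fin (suc n) → List A.Carrier → K.Carrier → M′
  high ℓ g c = ((const c * ι g) ⁽⁻¹⁾ * t-θ K[t].^ w ℓ) • m ℓ

  σ-low : Fin (suc n) → List A.Carrier → K.Carrier → M′
  σ-low ℓ g c = σ ((const c * ι g) • m ℓ)

  Integral-low⇒σ-low : ∀ {ℓ g} → Integral (low ℓ 0 g) → Integral (σ-low ℓ g)
  Integral-low⇒σ-low {ℓ} {g} g-int = Integral-σ (Integral-resp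
    (λ c h → T.*-congʳ {m ℓ h} (T.*-congˡ {const c} (T.*-identityˡ (ι g)))) g-int)

  high-zero : ∀ g c → σ-low zero g c ≋ᴹ high zero g c
  high-zero g c h = T.trans (σ-m (const c * ι g) zero h)
    (T.sym (T.*-assoc ((const c * ι g) ⁽⁻¹⁾) (t-θ K[t].^ w zero) (m zero h)))

  -- The index `inject₁ ℓ` is the predecessor of `suc ℓ`. The twist is multiplicative, so the
  -- unwanted coefficient is the twist of c g H, and g H is again over A; the sign in g′ makes it
  -- cancel.
  high-suc : ∀ ℓ g c → let g′ = A[t].- (g A[t].* H (pred (𝔰 (inject₁ ℓ)))) in
             σ-low (suc ℓ) g c +ᴹ high (inject₁ ℓ) g′ c ≋ᴹ high (suc ℓ) g c
  high-suc ℓ g c h = begin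
    σ-low (suc ℓ) g c h + (const c * ι g′) ⁽⁻¹⁾ * p₁ * x₁
      ≈⟨ T.+-cong (σ-m f (suc ℓ) h) (T.*-congʳ {x₁} (T.*-congʳ {p₁} twisted)) ⟩
    f ⁽⁻¹⁾ * (η * p₁ * x₁ + p₂ * x₂) + T.- (f ⁽⁻¹⁾ * η) * p₁ * x₁
      ≈⟨ cancel-middle (f ⁽⁻¹⁾) η p₁ x₁ p₂ x₂ ⟨
    f ⁽⁻¹⁾ * p₂ * x₂ ∎
    where
    h₁ = H (pred (𝔰 (inject₁ ℓ)))
    g′ = A[t].- (g A[t].* h₁)
    η  = H⁽⁻¹⁾ (inject₁ ℓ)
    f  = const c * ι g
    p₁ = t-θ K[t].^ w (inject₁ ℓ)
    p₂ = t-θ K[t].^ w (suc ℓ)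
    x₁ = m (inject₁ ℓ) h
    x₂ = m (suc ℓ) h

    twisted : (const c * ι g′) ⁽⁻¹⁾ ≋ T.- (f ⁽⁻¹⁾ * η)
    twisted = begin
      (const c * ι g′) ⁽⁻¹⁾              ≈⟨ twist-cong {const c * ι g′} {T.- (f * ι h₁)} (untwisted .at) ⟩
      (T.- (f * ι h₁)) ⁽⁻¹⁾              ≈⟨ twist-neg (f * ι h₁) ⟩
      T.- ((f * ι h₁) ⁽⁻¹⁾)              ≈⟨ T.-‿cong (twist-* f (ι h₁)) ⟩
      T.- (f ⁽⁻¹⁾ * η)                   ∎
      where
      untwisted : const c * ι g′ ≋ T.- (f * ι h₁)
      untwisted = begin
        const c * ι g′                   ≈⟨ T.*-congˡ {const c} (ι-neg (g A[t].* h₁)) ⟩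
        const c * (T.- ι (g A[t].* h₁))  ≈⟨ T.*-congˡ {const c} (T.-‿cong (ι-* g h₁)) ⟩
        const c * (T.- (ι g * ι h₁))     ≈⟨ T-ring.-‿distribʳ-* (const c) (ι g * ι h₁) ⟨
        T.- (const c * (ι g * ι h₁))     ≈⟨ T.-‿cong (T.*-assoc (const c) (ι g) (ι h₁)) ⟨
        T.- (f * ι h₁)                   ∎

  low-split : ∀ ℓ j g i → ν i ≡ (t-θ K[t].^ j) • m ℓ → ∀ c →
              const (ιA (remainder g) R.* c) • ν i +ᴹ low ℓ (suc j) (quotient g) c ≋ᴹ low ℓ j g c
  low-split ℓ j g i νᵢ≡ c h = begin
    const (a R.* c) * ν i h + const c * (t-θ * p * ι (quotient g)) * x
      ≡⟨ ≡.cong (λ y → const (a R.* c) * y h + const c * (t-θ * p * ι (quotient g)) * x) νᵢ≡ ⟩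
    const (a R.* c) * (p * x) + const c * (t-θ * p * ι (quotient g)) * x
      ≈⟨ T.+-congʳ {const c * (t-θ * p * ι (quotient g)) * x} (T.*-congʳ {p * x} (const-homo-* a c)) ⟩
    const a * const c * (p * x) + const c * (t-θ * p * ι (quotient g)) * x
      ≈⟨ split-off (const c) p (const a) t-θ (ι (quotient g)) x ⟨
    const c * (p * (const a + t-θ * ι (quotient g))) * x
      ≈⟨ T.*-congʳ {x} (T.*-congˡ {const c} (T.*-congˡ {p} (division g))) ⟨
    const c * (p * ι g) * x ∎
    where
    a = ιA (remainder g)
    p = t-θ K[t].^ j
    x = m ℓ h

  -- The q-th root undoes both the power c^q and the twist of g. This is the only place where the
  -- power of τ in a column grows.
  high-frob : ∀ ℓ g c → high ℓ (frobᴬ g) (frob 1 c) ≋ᴹ low ℓ (w ℓ) g c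
  high-frob ℓ g c h = T.*-congʳ {m ℓ h} (begin
    (const (frob 1 c) * ι (frobᴬ g)) ⁽⁻¹⁾ * p
      ≈⟨ T.*-congʳ {p} (twist-* (const (frob 1 c)) (ι (frobᴬ g))) ⟩
    const (qth-root (frob 1 c)) * ι (frobᴬ g) ⁽⁻¹⁾ * p
      ≈⟨ T.*-congʳ {p} (T.*-cong (const-cong (qth-root-unique R.refl)) (ι-frobᴬ g)) ⟩
    const c * ι g * p
      ≈⟨ T-multiplicative.x∙yz≈xz∙y (const c) p (ι g) ⟨
    const c * (p * ι g) ∎)
    where p = t-θ K[t].^ w ℓ

  -- The induction on ℓ and on the degree.

  module _ (w≥1 : ∀ ℓ → 1 ≤ w ℓ) where

    module _ ℓ (low⇒high : ∀ g → Integral (low ℓ 0 g) → Integral (high ℓ g)) where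

      peel : ∀ j g → j < w ℓ → Integral (low ℓ (suc j) (quotient g)) → Integral (low ℓ j g)
      peel j g j<w int with ν-at ℓ j j<w
      ... | i , νᵢ≡ = Integral-resp (low-split ℓ j g i νᵢ≡) (Integral-+ (Integral-ν (remainder g) i) int)

      -- Here k is the number of divisions leading from exponent j up to w_ℓ; none of them lengthens
      -- g, so the bound b persists.
      descend : ∀ b → (∀ g → length g ≤ b → Integral (low ℓ (w ℓ) g)) →
                ∀ k j → k ℕ.+ j ≡ w ℓ → ∀ g → length g ≤ b → Integral (low ℓ j g)
      descend b top zero    j ≡.refl g g≤b = top g g≤b
      descend b top (suc k) j k+j≡w  g g≤b = peel j g (≡.subst (suc j ≤_) k+j≡w (s≤s (ℕ.m≤n+m j k)))
        (descend b top k (suc j) (≡.trans (ℕ.+-suc k j) k+j≡w) (quotient g)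
          (ℕ.≤-trans (ℕ.≤-reflexive (length-quotient g)) (ℕ.≤-trans ℕ.pred[n]≤n g≤b)))

      -- Mutual recursion on b: any exponent is reduced to w_ℓ under the same bound, and exponent
      -- w_ℓ is reduced to exponent 1 under a smaller one.
      low-bounded : ∀ b k j → k ℕ.+ j ≡ w ℓ → ∀ g → length g ≤ b → Integral (low ℓ j g)
      top-bounded : ∀ b g → length g ≤ b → Integral (low ℓ (w ℓ) g)

      low-bounded b = descend b (top-bounded b)

      top-bounded zero    []      g≤b = Integral-resp
        (λ c h → T.sym (T.trans (T.*-congʳ {m ℓ h} (T.trans
          (T.*-congˡ {const c} (T.zeroʳ (t-θ K[t].^ w ℓ))) (T.zeroʳ (const c)))) (T.zeroˡ (m ℓ h))))
        Integral-0
      -- The division at exponent 0 is carried out before recursing: `frobᴬ` keeps the length, and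
      -- only the quotient has length at most b. It is available because w_ℓ is at least 1.
      top-bounded (suc b) g g≤b = Integral-resp (high-frob ℓ g)
        (Integral-frob (low⇒high (frobᴬ g) (peel 0 (frobᴬ g) (w≥1 ℓ)
          (low-bounded b (pred (w ℓ)) 1 (≡.trans (ℕ.+-comm (pred (w ℓ)) 1) (ℕ.suc-pred (w ℓ) ⦃ ℕ.>-nonZero (w≥1 ℓ) ⦄))
            (quotient (frobᴬ g)) short))))
        where
        short : length (quotient (frobᴬ g)) ≤ b
        short = ℕ.≤-trans
          (ℕ.≤-reflexive (≡.trans (length-quotient (frobᴬ g)) (≡.cong pred (List.length-map _ g))))
          (ℕ.pred-mono-≤ g≤b)

      low-integral : ∀ j → j ≤ w ℓ → ∀ g → Integral (low ℓ j g)
      low-integral j j≤w g = low-bounded (length g) (w ℓ ∸ j) j (ℕ.m∸n+n≡m j≤w) g ℕ.≤-refl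

    -- At `suc ℓ` the premise handles the term under σ. The correction term lives at the preceding
    -- index, where the induction hypothesis is used twice: to make every `low` integral there, and
    -- to pass from that to `high`.
    low⇒high : ∀ ℓ g → Integral (low ℓ 0 g) → Integral (high ℓ g)
    low⇒high = <-weakInduction (λ ℓ → ∀ g → Integral (low ℓ 0 g) → Integral (high ℓ g))
      (λ g int → Integral-resp (high-zero g) (Integral-low⇒σ-low {zero} {g} int))
      (λ ℓ rec g int → let g′ = A[t].- (g A[t].* H (pred (𝔰 (inject₁ ℓ)))) in
        Integral-resp (high-suc ℓ g) (Integral-+ (Integral-low⇒σ-low {suc ℓ} {g} int)
          (rec g′ (low-integral (inject₁ ℓ) rec 0 z≤n g′))))

    Integral-low : ∀ ℓ j → j ≤ w ℓ → ∀ g → Integral (low ℓ j g)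
    Integral-low ℓ = low-integral ℓ (low⇒high ℓ)

    Integral-high : ∀ ℓ g → Integral (high ℓ g)
    Integral-high ℓ g = low⇒high ℓ g (Integral-low ℓ 0 z≤n g)

    -- Consequences for ρ_t and for the special point.

    module _ (E′ : TModule) where
      open TModule E′

      Δ-↝ : ∀ {x v} → x ↝ v → Δ x ≈ᶜ v
      Δ-↝ {x} x↝v i = R.trans (Δ-expand x (x↝v .coords) (λ ℓ → x↝v .expand ℓ .at) i) (x↝v .value i)

      tν-integral : ∀ i → Integral (λ c → List.map ι𝔽 (Polynomials.X (DiscreteField.rawRing 𝔽)) • const c • ν i)
      tν-integral i = let (ℓ , k) = block w i ; j = w ℓ ∸ suc (toℕ k) ; p = t-θ K[t].^ j in
        Integral-resp (λ c h → begin
          const c * (p * ι A-poly.X) * m ℓ h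
            ≈⟨ T.*-congʳ {m ℓ h} (T-multiplicative.x∙yz≈z∙xy (const c) p (ι A-poly.X)) ⟩
          ι A-poly.X * (const c * p) * m ℓ h
            ≈⟨ T.*-assoc (ι A-poly.X) (const c * p) (m ℓ h) ⟩
          ι A-poly.X * (const c * p * m ℓ h)
            ≈⟨ T.*-cong ι-X (T.*-assoc (const c) p (m ℓ h)) ⟩
          List.map ι𝔽 (Polynomials.X (DiscreteField.rawRing 𝔽)) * (const c * (p * m ℓ h)) ∎)
          (Integral-low ℓ j (ℕ.m∸n≤m (w ℓ) (suc (toℕ k))) A-poly.X)
        where
        -- The two readings of t differ in the constant term: the zero of A is the empty list, that
        -- coming from 𝔽 the list with the single entry 0.
        ι-X : ι A-poly.X ≋ List.map ι𝔽 (Polynomials.X (DiscreteField.rawRing 𝔽))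
        ι-X = ∷-cong (ιA.⟦⟧-cong λ { zero → 𝔽.refl ; (suc _) → 𝔽.refl }) T.refl
          where module 𝔽 = DiscreteField 𝔽

      Δ-ν : ∀ c i → Δ (const c • ν i) ≈ᶜ (δ ∘ single i c)
      Δ-ν c i = Δ-↝ (↝-ν c i)

      -- Δ(c ν_i) is c times the i-th unit vector, so ρ_t applied to it reads off the i-th column at
      -- c.
      ρ-t-ν : ∀ c i j → (ρ-t ⟨ Δ (const c • ν i) ⟩) j R.≈ evalᵀ (ρ-t j i) c
      ρ-t-ν c i j = R.trans (SumProperties.sum-single K-ring i _ off-diagonal)
        (evalᵀ-congʳ (ρ-t j i) (R.trans (Δ-ν c i i) diagonal))
        where
        off-diagonal : ∀ l → i ≢ l → evalᵀ (ρ-t j l) (Δ (const c • ν i) l) R.≈ R.0#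
        off-diagonal l i≢l = R.trans (evalᵀ-congʳ (ρ-t j l)
          (R.trans (Δ-ν c i l) (R.reflexive (≡.cong δ (single-≢ c i≢l))))) (evalᵀ-0 (ρ-t j l))

        diagonal : δ (single i c i) R.≈ c
        diagonal rewrite single-≡ i c = R.trans (R.+-identityʳ _) (frob-zero c)

      ρ-t-over-A : IsOverA ρ-t
      ρ-t-over-A = (λ j i → tν-integral i .column j) , λ j i →
        evalᵀ-injective (ρ-t j i) (ι (tν-integral i .column j)) (λ c → R.trans (R.sym (ρ-t-ν c i j))
          (R.trans (ρ-Δ _ (const c • ν i) j) (Δ-↝ (tν-integral i .expands c) j))) .at

      sumᴬ : List A.Carrier → A.Carrier
      sumᴬ = List.foldr A._+_ A.0#

      -- At c = 1 every power c^(q^i) is 1, so a column over A takes a value in A.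
      evalᵀ-1 : ∀ f → evalᵀ (ι f) R.1# R.≈ ιA (sumᴬ f)
      evalᵀ-1 []      = R.sym ιA.0#-homo
      evalᵀ-1 (a ∷ f) = R.trans (evalᵀ-∷ (ιA a) (ι f) R.1#) (R.trans
        (R.+-cong (R.*-identityʳ _) (R.trans (evalᵀ-congʳ (ι f) (frob-1 1)) (evalᵀ-1 f)))
        (R.sym (ιA.+-homo a (sumᴬ f))))

      special-point-integral : IsIntegral special-point
      special-point-integral = (λ i → sumᴬ (int .column i)) , λ i →
        R.trans (Δ-↝ (↝-respˡ point (int .expands R.1#)) i) (evalᵀ-1 (int .column i))
        where
        L = fromℕ n
        h = H (pred (𝔰 L))
        -- The special point is `high` at the last index, with g = H_(s_r - 1) and c = 1.
        int = Integral-high L h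

        point : high L h R.1# ≋ᴹ (H⁽⁻¹⁾ L * t-θ K[t].^ 𝔰 L) • m L
        point l rewrite weight-last 𝔰 = T.*-congʳ {m L l} (T.*-congʳ {t-θ K[t].^ 𝔰 L}
          (twist-cong {T.1# * ι h} {ι h} (T.*-identityˡ (ι h) .at)))

open import Data.Product.Base using (_×_)

theorem5p3p4 : ∀ {c ℓ₁ ℓ₂} (B : BaseData c ℓ₁ ℓ₂)
    (H : ℕ → RawRing.Carrier (BaseData.A[t] B)) → AndersonThakur.IsAndersonThakur B H →
    ∀ {n} (𝔰 : Vector ℕ (suc n)) → (∀ ℓ → 1 ≤ 𝔰 ℓ) →
    (E′ : Construction.TModule B H 𝔰) →
    Construction.IsOverA B H 𝔰 (Construction.TModule.ρ-t E′)
    × Construction.IsIntegral B H 𝔰 (Construction.TModule.special-point E′)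
theorem5p3p4 B H _ 𝔰 𝔰≥1 E′ =
  ρ-t-over-A w≥1 E′ , special-point-integral w≥1 E′
  where
  open Expansion B H 𝔰
  w≥1 = weight-positive 𝔰 𝔰≥1
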